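{- Let $G=(V,E)$ be an undirected graph with $n=|V|$ vertices and $m=|E|$ edges, let $\bar\delta$ be its average degeneracy, and let $\#C_4$ be the number of distinct 4-cycles in $G$. Enumerating the 4-cycles of $G$ (that is, outputting each distinct 4-cycle of $G$ exactly once) takes $O(m\bar\delta+\#C_4)$ time and $O(n)$ space; i.e. there is an algorithm which, given any such $G$, performs this enumeration within these bounds.
   Context: Graphs are finite, simple and undirected, with vertices labeled by $[n]=\{1,\dots,n\}$; $N(v)=\{u: uv\in E\}$ and $d(v)=|N(v)|$. The average degeneracy is $\bar\delta=\frac1m\sum_{uv\in E}\min\{d(u),d(v)\}$. A 4-cycle ($C_4$) is a sequence of four distinct vertices $x,y,z,w$ with $xy,yz,zw,wx\in E$; the eight sequences obtained from it by cyclic shifts and reversal count as a single distinct 4-cycle. Computational model: the input graph is given in adjacency-list form, with an arbitrary ordering of the neighbors of each vertex; vertex degrees can be looked up in constant time; array access, linked-list operations, comparison and addition on words take constant time. Time bounds are worst-case bounds for deterministic algorithms (no hashing or randomness). Space is measured in words and does not include the storage of the input graph; the enumerated 4-cycles are emitted one at a time as output and are not stored. -}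

module Defs where

open import Data.Fin.Base using (Fin; toℕ)
import Data.Fin.Properties as Fin
open import Data.Integer.Base using (+_)
open import Data.List.Base
  using (List; []; _∷_; _++_; map; filter; length; take; concatMap;
         allFin; cartesianProduct; deduplicate; lookup)
open import Data.List.Membership.Propositional using (_∈_)
open import Data.List.Relation.Unary.All using (All)
open import Data.List.Relation.Unary.AllPairs using (AllPairs)
open import Data.List.Relation.Unary.Any using (Any)
open import Data.List.Relation.Unary.Unique.Propositional using (Unique)
import Data.List.Membership.DecPropositional as DecMembership
import Data.List.Relation.Unary.Unique.DecPropositional as DecUnique
open import Data.Nat.Base using (ℕ; zero; suc; _+_; _*_; _^_; _≤_; _<_; _⊓_)
open import Data.Nat.ListAction using (sum)
open import Data.Product.Base using (Σ-syntax; _×_; _,_)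
open import Data.Product.Properties using (≡-dec)
import Data.Rational.Base as ℚ
open ℚ using (ℚ; 0ℚ; 1ℚ)
open import Data.Vec.Base as Vec using (Vec; _[_]≔_)
open import Function.Bundles using (_⇔_)
open import Relation.Binary.Definitions using (DecidableEquality; Decidable; Symmetric)
open import Relation.Binary.PropositionalEquality using (_≡_)
open import Relation.Nullary using (¬_; Dec)
open import Relation.Nullary.Decidable using (_×-dec_)

------------------------------------------------------------------------
-- Graphs

-- The vertices 1, …, n are represented by Fin n, i.e. as 0, …, n-1.
record Graph (n : ℕ) : Set₁ where
  field
    Edge   : Fin n → Fin n → Set
    edge?  : Decidable Edge
    sym    : Symmetric Edge
    irrefl : ∀ {v} → ¬ Edge v v

module _ {n : ℕ} (G : Graph n) where
  open Graph G

  N : Fin n → List (Fin n)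
  N v = filter (edge? v) (allFin n)

  d : Fin n → ℕ
  d v = length (N v)

  -- Each edge is listed once, with its smaller endpoint first.
  edges : List (Fin n × Fin n)
  edges = filter (λ (u , v) → (u Fin.<? v) ×-dec edge? u v)
                 (cartesianProduct (allFin n) (allFin n))

  numEdges : ℕ
  numEdges = length edges

fromℕ : ℕ → ℚ
fromℕ k = + k ℚ./ 1

-- The junk value at denominator 0 is only met for edgeless graphs.
_÷_ : ℕ → ℕ → ℚ
k ÷ zero  = 0ℚ
k ÷ suc l = + k ℚ./ suc l

avgDegeneracy : ∀ {n} → Graph n → ℚ
avgDegeneracy G = sum (map (λ (u , v) → d G u ⊓ d G v) (edges G)) ÷ numEdges G

------------------------------------------------------------------------
-- 4-cycles

Quad : Set → Set
Quad A = A × A × A × A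

shift reversal : ∀ {A} → Quad A → Quad A
shift    (x , y , z , w) = y , z , w , x
reversal (x , y , z , w) = w , z , y , x

rotations orbit : ∀ {A} → Quad A → List (Quad A)
rotations q = q ∷ shift q ∷ shift (shift q) ∷ shift (shift (shift q)) ∷ []
orbit     q = rotations q ++ rotations (reversal q)

infix 4 _≈_ _≈?_

_≈_ : ∀ {A} → Quad A → Quad A → Set
p ≈ q = p ∈ orbit q

_≟Quad_ : ∀ {n} → DecidableEquality (Quad (Fin n))
_≟Quad_ = ≡-dec Fin._≟_ (≡-dec Fin._≟_ (≡-dec Fin._≟_ Fin._≟_))

_≈?_ : ∀ {n} → Decidable (_≈_ {Fin n})
p ≈? q = DecMembership._∈?_ _≟Quad_ p (orbit q)

module _ {n : ℕ} (G : Graph n) where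
  open Graph G

  IsC4 : Quad (Fin n) → Set
  IsC4 (x , y , z , w) =
    Unique (x ∷ y ∷ z ∷ w ∷ []) × Edge x y × Edge y z × Edge z w × Edge w x

  isC4? : ∀ q → Dec (IsC4 q)
  isC4? (x , y , z , w) =
    DecUnique.unique? Fin._≟_ (x ∷ y ∷ z ∷ w ∷ [])
      ×-dec edge? x y ×-dec edge? y z ×-dec edge? z w ×-dec edge? w x

  allQuads : List (Quad (Fin n))
  allQuads = cartesianProduct V (cartesianProduct V (cartesianProduct V V))
    where V = allFin n

  #C4 : ℕ
  #C4 = length (deduplicate _≈?_ (filter isC4? allQuads))

  record Enumerates (out : List (Quad (Fin n))) : Set where
    field
      sound    : All IsC4 out
      complete : ∀ q → IsC4 q → Any (q ≈_) out
      distinct : AllPairs (λ p q → ¬ p ≈ q) out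

------------------------------------------------------------------------
-- Input: adjacency lists, each in an arbitrary order

record AdjacencyLists {n : ℕ} (G : Graph n) : Set where
  field
    nbrs   : Fin n → List (Fin n)
    unique : ∀ v → Unique (nbrs v)
    spec   : ∀ v u → u ∈ nbrs v ⇔ Graph.Edge G v u

  -- The lists are stored one after another in a single array adj; the list
  -- of v occupies deg v consecutive cells beginning at position start v.
  deg : Fin n → ℕ
  deg v = length (nbrs v)

  start : Fin n → ℕ
  start v = sum (map deg (take (toℕ v) (allFin n)))

  adj : List (Fin n)
  adj = concatMap nbrs (allFin n)

------------------------------------------------------------------------
-- Machine model: structured programs with k registers and a work arrays.
-- The program text depends on neither the input nor the word size.

data Operand (k : ℕ) : Set where
  reg : Fin k → Operand k
  lit : ℕ → Operand k

data Expr (k a : ℕ) : Set where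
  val       : Operand k → Expr k a
  _⊕_       : Operand k → Operand k → Expr k a
  read      : Fin a → Operand k → Expr k a
  sizeV     : Expr k a
  sizeAdj   : Expr k a
  readDeg   : Operand k → Expr k a
  readStart : Operand k → Expr k a
  readAdj   : Operand k → Expr k a

data Test (k : ℕ) : Set where
  _==_ _<<_ : Operand k → Operand k → Test k

infixr 5 _⨾_

data Program (k a : ℕ) : Set where
  skip          : Program k a
  _:=_          : Fin k → Expr k a → Program k a
  write_at_val_ : Fin a → Operand k → Operand k → Program k a
  emit          : Quad (Operand k) → Program k a
  _⨾_           : Program k a → Program k a → Program k a
  if_then_else_ : Test k → Program k a → Program k a → Program k a
  while_run_    : Test k → Program k a → Program k a

-- A word is a number below B.  The state is exactly k + a * s words:
-- the k registers and the a work arrays, each of length s.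
record State (k a s B : ℕ) : Set where
  constructor state
  field
    regs   : Vec (Fin B) k
    arrays : Vec (Vec (Fin B) s) a

module _ {k a s B : ℕ} where
  open State

  ⟦_⟧ : Operand k → State k a s B → ℕ
  ⟦ reg r ⟧ σ = toℕ (Vec.lookup (regs σ) r)
  ⟦ lit c ⟧ σ = c

  Holds : Test k → State k a s B → Set
  Holds (x == y) σ = ⟦ x ⟧ σ ≡ ⟦ y ⟧ σ
  Holds (x << y) σ = ⟦ x ⟧ σ < ⟦ y ⟧ σ

  setReg : Fin k → Fin B → State k a s B → State k a s B
  setReg r w σ = record σ { regs = regs σ [ r ]≔ w }

  setCell : Fin a → Fin s → Fin B → State k a s B → State k a s B
  setCell A i w σ =
    record σ { arrays = arrays σ [ A ]≔ (Vec.lookup (arrays σ) A [ i ]≔ w) }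

  module _ {n : ℕ} {G : Graph n} (L : AdjacencyLists G) where
    open AdjacencyLists L

    -- There is no rule for an index out of range: such programs get stuck.
    data Eval (σ : State k a s B) : Expr k a → ℕ → Set where
      val       : ∀ {x} → Eval σ (val x) (⟦ x ⟧ σ)
      add       : ∀ {x y} → Eval σ (x ⊕ y) (⟦ x ⟧ σ + ⟦ y ⟧ σ)
      read      : ∀ {A x} (i : Fin s) → toℕ i ≡ ⟦ x ⟧ σ →
                  Eval σ (read A x) (toℕ (Vec.lookup (Vec.lookup (arrays σ) A) i))
      sizeV     : Eval σ sizeV n
      sizeAdj   : Eval σ sizeAdj (length adj)
      readDeg   : ∀ {x} (v : Fin n) → toℕ v ≡ ⟦ x ⟧ σ → Eval σ (readDeg x) (deg v)
      readStart : ∀ {x} (v : Fin n) → toℕ v ≡ ⟦ x ⟧ σ → Eval σ (readStart x) (start v)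
      readAdj   : ∀ {x} (i : Fin (length adj)) → toℕ i ≡ ⟦ x ⟧ σ →
                  Eval σ (readAdj x) (toℕ (lookup adj i))

    -- Run p σ t out σ′: started in σ, p halts in σ′ after t steps, having
    -- emitted out.  Results that do not fit in a word get stuck, as do emitted
    -- words that are not vertices.
    data Run : Program k a → State k a s B →
               ℕ → List (Quad (Fin n)) → State k a s B → Set where
      skip   : ∀ {σ} → Run skip σ 1 [] σ
      assign : ∀ {σ r e} (w : Fin B) → Eval σ e (toℕ w) →
               Run (r := e) σ 1 [] (setReg r w σ)
      write  : ∀ {σ A x y} (i : Fin s) (w : Fin B) →
              toℕ i ≡ ⟦ x ⟧ σ → toℕ w ≡ ⟦ y ⟧ σ →
              Run (write A at x val y) σ 1 [] (setCell A i w σ)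
      emit   : ∀ {σ x₁ x₂ x₃ x₄} (v₁ v₂ v₃ v₄ : Fin n) →
              toℕ v₁ ≡ ⟦ x₁ ⟧ σ → toℕ v₂ ≡ ⟦ x₂ ⟧ σ →
              toℕ v₃ ≡ ⟦ x₃ ⟧ σ → toℕ v₄ ≡ ⟦ x₄ ⟧ σ →
              Run (emit (x₁ , x₂ , x₃ , x₄)) σ 1 ((v₁ , v₂ , v₃ , v₄) ∷ []) σ
      seq    : ∀ {σ σ′ σ″ p q t u os os′} →
              Run p σ t os σ′ → Run q σ′ u os′ σ″ →
              Run (p ⨾ q) σ (t + u) (os ++ os′) σ″
      ifTrue  : ∀ {σ σ′ b p q t os} → Holds b σ → Run p σ t os σ′ →
                Run (if b then p else q) σ (suc t) os σ′
      ifFalse : ∀ {σ σ′ b p q t os} → ¬ Holds b σ → Run q σ t os σ′ →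
                Run (if b then p else q) σ (suc t) os σ′
      whileTrue  : ∀ {σ σ′ σ″ b p t u os os′} → Holds b σ →
                   Run p σ t os σ′ → Run (while b run p) σ′ u os′ σ″ →
                   Run (while b run p) σ (suc (t + u)) (os ++ os′) σ″
      whileFalse : ∀ {σ b p} → ¬ Holds b σ → Run (while b run p) σ 1 [] σ

-- Any run takes a step and any program may use registers, so O(f) is read as
-- ≤ c (1 + f).  The extra 1 only matters for graphs without edges (time) and
-- without vertices (space), since m δ̄ ≥ 1 as soon as m ≥ 1.

timeBound : ∀ {n} → ℕ → Graph n → ℚ
timeBound c G =
  fromℕ c ℚ.* (1ℚ ℚ.+ (fromℕ (numEdges G) ℚ.* avgDegeneracy G ℚ.+ fromℕ (#C4 G)))

spaceBound : ℕ → ℕ → ℕ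
spaceBound c n = c * (1 + n)

-- Words have O(log n) bits, i.e. hold numbers below a fixed power of n + 2.
wordBound : ℕ → ℕ → ℕ
wordBound e n = (2 + n) ^ e

-- The initial contents σ₀ of the working memory are arbitrary.
EnumeratesC4Within : ∀ {k a} → Program k a → (e c : ℕ) → Set₁
EnumeratesC4Within {k} {a} p e c =
  ∀ n → Σ[ s ∈ ℕ ] (k + a * s ≤ spaceBound c n) ×
    ((G : Graph n) (L : AdjacencyLists G) (σ₀ : State k a s (wordBound e n)) →
     Σ[ t ∈ ℕ ] Σ[ out ∈ List (Quad (Fin n)) ] Σ[ σ′ ∈ State k a s (wordBound e n) ]
       Run L p σ₀ t out σ′ × Enumerates G out × (fromℕ t ℚ.≤ timeBound c G))

{-# OPTIONS --safe #-}
module Submission where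

-- Order the vertices by degree, ties being broken by name. A 4-cycle with
-- ≺-maximal vertex v and opposite vertex y is a pair of 2-paths v - u - y and
-- v - u′ - y with u, u′, y ≺ v. As d(u) = min (d(u), d(v)) for u ≺ v, scanning
-- the neighbours of all neighbours u ≺ v of every v takes time O(m δ̄).
--
-- Storing all 2-paths from v might need more than O(n) space. So a pass stores
-- n of them only, in linked lists according to their ends y, and matches these
-- with all later ones; if v has T 2-paths to vertices y ≺ v, there are about
-- q = T / n further passes, each storing the next n. These are paid for by the
-- 4-cycles: if c_y is the number of 2-paths from v to y, then Σ (c_y - q)² ≥ 0
-- yields 2 q Σ c_y ≤ Σ c_y² + n q², where n q² ≤ q T, and Σ c_y² is Σ c_y plus
-- twice the number of pairs of 2-paths with a common end. Applied to the y ≺ v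
-- and to the y ≻ v separately, the pairs inject into the 4-cycles.
--
-- Time O(n) is not allowed when most vertices are isolated. Hence vertices are
-- found by running through the adjacency array, and no array is initialised.

-- A pass over the neighbours of the `u ≺ v` cannot avoid looking at the ends y ≻ v. So a further
-- pass costs about as much as there are 2-paths to y ≺ v and to y ≻ v together, while the number q
-- of further passes is governed by the former alone. This is why the latter have to be charged as
-- well. Their pairs are the 4-cycles v - u - y - u′ with u, u′ ≺ v ≺ y: here y is the maximum and v
-- its opposite, so the cycle determines v, just as it does when v is the maximum. Each of the two
-- families is therefore counted at most once by the number of 4-cycles.
--
-- The machine has bounded words and arbitrary initial memory, and the passes emit the pairs in an
-- order that no simple recursion on the list of 2-paths produces. Programs are therefore executed
-- on stores of natural numbers, with the time bounded from above and the output taken up to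
-- permutation. A single simulation carries the result over to the machine.

open import Defs
open import Data.Bool.Base using (Bool; false; _∨_)
  renaming (if_then_else_ to ifᵇ_then_else_)
open import Data.Bool.Properties using (∨-conicalˡ; ∨-conicalʳ)
open import Data.Fin using (#_)
open import Data.Fin.Base as Fin using (Fin; toℕ; fromℕ<)
import Data.Fin.Properties as Fin
open import Data.Integer.Base as ℤ using () renaming (+_ to int)
import Data.Integer.Properties as ℤ
open import Data.List.Base
  using (List; []; _∷_; _++_; length; lookup; map; filter; take; drop; concatMap;
         deduplicate; allFin; tabulate)
import Data.List.Properties as List
open import Data.List.Membership.Propositional using (_∈_; find; lose)
import Data.List.Membership.Propositional.Properties as ∈
open import Data.List.Relation.Binary.Permutation.Propositional
  using (_↭_; prep; ↭-refl; ↭-trans; ↭-sym; ↭-reflexive; ↭⇒↭ₛ; module PermutationReasoning)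
open import Data.List.Relation.Binary.Permutation.Propositional.Properties
  using (++⁺; ++⁺ˡ; ++⁺ʳ; shifts; ↭-length; All-resp-↭; Any-resp-↭)
import Data.List.Relation.Binary.Permutation.Setoid.Properties as Permutation
open import Data.List.Relation.Unary.All as All using (All; []; _∷_)
import Data.List.Relation.Unary.All.Properties as All
open import Data.List.Relation.Unary.AllPairs as AllPairs using (AllPairs; []; _∷_)
import Data.List.Relation.Unary.AllPairs.Properties as AllPairs
open import Data.List.Relation.Unary.Any as Any using (Any; here; there)
  renaming (_─_ to _without_)
open import Data.List.Relation.Unary.Unique.Propositional using (Unique)
import Data.List.Relation.Unary.Unique.Propositional.Properties as Unique
open import Data.Nat.Base
open import Data.Nat.ListAction using (sum)
open import Data.Nat.ListAction.Properties using (sum-++)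
open import Data.Nat.Properties
open import Data.Nat.Tactic.RingSolver using (solve-∀)
open import Data.Product.Base using (Σ-syntax; _×_; _,_; proj₁; proj₂; swap)
import Data.Rational.Base as ℚ
import Data.Rational.Properties as ℚ
open import Data.Rational.Unnormalised.Base as ℚᵘ using (mkℚᵘ; _≃_; *≡*; *≤*)
import Data.Rational.Unnormalised.Properties as ℚᵘ
open import Data.Sum.Base using (_⊎_; inj₁; inj₂; [_,_])
open import Data.Unit.Base using (⊤; tt)
import Data.Vec.Base as Vec
import Data.Vec.Properties as Vec
open import Function.Base using (_∘_)
open import Function.Bundles using (Equivalence)
open import Relation.Binary.Definitions using (tri<; tri≈; tri>)
open import Relation.Binary.PropositionalEquality hiding ([_])
open import Relation.Nullary using (¬_; yes; no; does; contradiction; Dec)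
open import Relation.Nullary.Decidable using (_×-dec_; ¬?; dec-true; dec-false)

-- Lists and sums

module _ {A : Set} where

  Any-without : ∀ {P Q : A → Set} {xs} → (∀ {x} → P x → ¬ Q x) → (p : Any P xs) → Any Q xs → Any Q (xs without p)
  Any-without disj (here px)  (here qx)  = contradiction qx (disj px)
  Any-without disj (here px)  (there q)  = q
  Any-without disj (there p)  (here qx)  = here qx
  Any-without disj (there p)  (there q)  = there (Any-without disj p q)

  sum-without : ∀ (g : A → ℕ) {P : A → Set} {xs} (p : Any P xs) →
    sum (map g xs) ≡ g (Any.lookup p) + sum (map g (xs without p))
  sum-without g (here px) = refl
  sum-without g (there {x = x} p) =
    trans (cong (g x +_) (sum-without g p)) (shuffle (g x) (g (Any.lookup p)) _)
    where
    shuffle : ∀ a b c → a + (b + c) ≡ b + (a + c)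
    shuffle = solve-∀

  length-sum : ∀ (xs : List A) → length xs ≡ sum (map (λ _ → 1) xs)
  length-sum []       = refl
  length-sum (x ∷ xs) = cong suc (length-sum xs)

  sum-map-+ : ∀ (f g : A → ℕ) xs → sum (map (λ x → f x + g x) xs) ≡ sum (map f xs) + sum (map g xs)
  sum-map-+ f g []       = refl
  sum-map-+ f g (x ∷ xs) = trans (cong (f x + g x +_) (sum-map-+ f g xs)) (shuffle (f x) (g x) _ _)
    where
    shuffle : ∀ a b c d → a + b + (c + d) ≡ a + c + (b + d)
    shuffle = solve-∀

  sum-map-* : ∀ c (f : A → ℕ) xs → sum (map (λ x → c * f x) xs) ≡ c * sum (map f xs)
  sum-map-* c f []       = sym (*-zeroʳ c)
  sum-map-* c f (x ∷ xs) = trans (cong (c * f x +_) (sum-map-* c f xs)) (sym (*-distribˡ-+ c _ _))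

  sum-map-mono : ∀ {f g : A → ℕ} xs → (∀ {x} → x ∈ xs → f x ≤ g x) → sum (map f xs) ≤ sum (map g xs)
  sum-map-mono []       f≤g = z≤n
  sum-map-mono (x ∷ xs) f≤g = +-mono-≤ (f≤g (here refl)) (sum-map-mono xs (f≤g ∘ there))

  sum-concatMap : ∀ {B : Set} (f : B → ℕ) (g : A → List B) xs →
    sum (map f (concatMap g xs)) ≡ sum (map (λ x → sum (map f (g x))) xs)
  sum-concatMap f g []       = refl
  sum-concatMap f g (x ∷ xs) =
    trans (cong sum (List.map-++ f (g x) _))
      (trans (sum-++ (map f (g x)) _) (cong (sum (map f (g x)) +_) (sum-concatMap f g xs)))

  length-concatMap : ∀ {B : Set} (g : A → List B) xs → length (concatMap g xs) ≡ sum (map (length ∘ g) xs)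
  length-concatMap g []       = refl
  length-concatMap g (x ∷ xs) = trans (List.length-++ (g x)) (cong (length (g x) +_) (length-concatMap g xs))

module _ {A : Set} {P : A → Set} (P? : ∀ x → Dec (P x)) where

  -- The left side is the cost of a loop whose body takes `c` steps and runs a branch of cost `f x`
  -- only if a test succeeds.
  sum-filter : ∀ c (f : A → ℕ) xs → sum (map (λ x → c + (ifᵇ does (P? x) then f x else 0)) xs) ≡
    c * length xs + sum (map f (filter P? xs))
  sum-filter c f [] = sym (trans (+-identityʳ (c * 0)) (*-zeroʳ c))
  sum-filter c f (x ∷ xs) with P? x
  ... | yes _ = trans (cong (c + f x +_) (sum-filter c f xs)) (shuffle c (f x) (length xs) _)
    where
    shuffle : ∀ c b l s → c + b + (c * l + s) ≡ c * suc l + (b + s)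
    shuffle = solve-∀
  ... | no _  = trans (cong (c + 0 +_) (sum-filter c f xs)) (shuffle c (length xs) _)
    where
    shuffle : ∀ c l s → c + 0 + (c * l + s) ≡ c * suc l + s
    shuffle = solve-∀

  concatMap-filter : ∀ {B : Set} (f : A → List B) xs →
    concatMap (λ x → ifᵇ does (P? x) then f x else []) xs ≡ concatMap f (filter P? xs)
  concatMap-filter f [] = refl
  concatMap-filter f (x ∷ xs) with P? x
  ... | yes _ = cong (f x ++_) (concatMap-filter f xs)
  ... | no _  = concatMap-filter f xs

  sum-filter-≤ : ∀ {f g : A → ℕ} xs → (∀ {x} → P x → f x ≤ g x) →
    sum (map f (filter P? xs)) ≤ sum (map g xs)
  sum-filter-≤ [] f≤g = z≤n
  sum-filter-≤ (x ∷ xs) f≤g with P? x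
  ... | yes p = +-mono-≤ (f≤g p) (sum-filter-≤ xs f≤g)
  ... | no _  = ≤-trans (sum-filter-≤ xs f≤g) (m≤n+m _ _)

module _ {A B : Set} (Rep : A → B → Set) (f : A → ℕ) (g : B → ℕ) where

  -- Greedy matching: the representative of the head is removed from `ys`, and since no two elements
  -- share a representative, the others keep theirs. With `_≡_` this compares a repetition-free list
  -- with one containing it; with `_≈_` it compares emitted quads with `#C4`.
  sum-≤-reps : ∀ {xs ys} → AllPairs (λ x x′ → ∀ {y} → Rep x y → ¬ Rep x′ y) xs →
    All (λ x → Any (λ y → Rep x y × f x ≤ g y) ys) xs → sum (map f xs) ≤ sum (map g ys)
  sum-≤-reps [] [] = z≤n
  sum-≤-reps {x ∷ xs} {ys} (apart ∷ aparts) (rep ∷ reps) = begin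
    f x + sum (map f xs)
      ≤⟨ +-mono-≤ (proj₂ (lookup-result rep)) (sum-≤-reps aparts
           (All.map (λ (ap , r) → Any-without (λ (p , _) (q , _) → ap p q) rep r) (All.zip (apart , reps)))) ⟩
    g (Any.lookup rep) + sum (map g (ys without rep))
      ≡⟨ sum-without g rep ⟨
    sum (map g ys) ∎
    where
    open ≤-Reasoning
    lookup-result : ∀ {P : B → Set} {ys} (p : Any P ys) → P (Any.lookup p)
    lookup-result (here px) = px
    lookup-result (there p) = lookup-result p

module _ {A : Set} (f g : A → ℕ) where

  sum-≤-⊆ : ∀ {xs ys} → Unique xs → (∀ {x} → x ∈ xs → x ∈ ys × f x ≤ g x) → sum (map f xs) ≤ sum (map g ys)
  sum-≤-⊆ {xs} {ys} u sub = sum-≤-reps _≡_ f g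
    (AllPairs.map (λ x≢x′ {y} x≡y x′≡y → x≢x′ (trans x≡y (sym x′≡y))) u)
    (All.tabulate λ x∈xs → let x∈ys , le = sub x∈xs in Any.map (λ { refl → refl , le }) x∈ys)

length-≤-⊆ : ∀ {A : Set} {xs ys : List A} → Unique xs → (∀ {x} → x ∈ xs → x ∈ ys) → length xs ≤ length ys
length-≤-⊆ {xs = xs} {ys} u sub =
  subst₂ _≤_ (sym (length-sum xs)) (sym (length-sum ys)) (sum-≤-⊆ _ _ u λ x∈ → sub x∈ , ≤-refl)

module _ {A : Set} {P : A → Set} {R S : A → A → Set} where

  AllPairs-map-All : (∀ {x y} → P x → P y → R x y → S x y) → ∀ {xs} → All P xs → AllPairs R xs → AllPairs S xs
  AllPairs-map-All f [] [] = []
  AllPairs-map-All f (px ∷ pxs) (r ∷ rs) =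
    All.map (λ (py , rxy) → f px py rxy) (All.zip (pxs , r)) ∷ AllPairs-map-All f pxs rs

module _ {A B : Set} (f : A → List B) where

  fibres : List A → List (A × B)
  fibres = concatMap λ a → map (a ,_) (f a)

  ∈-fibres⁺ : ∀ {xs a b} → a ∈ xs → b ∈ f a → (a , b) ∈ fibres xs
  ∈-fibres⁺ a∈ b∈ = ∈.∈-concatMap⁺ _ (Any.map (λ { refl → ∈.∈-map⁺ _ b∈ }) a∈)

  ∈-fibres⁻ : ∀ {xs a b} → (a , b) ∈ fibres xs → a ∈ xs × b ∈ f a
  ∈-fibres⁻ {x ∷ xs} h with ∈.∈-++⁻ (map (x ,_) (f x)) h
  ... | inj₂ h′ = let a∈ , b∈ = ∈-fibres⁻ {xs} h′ in there a∈ , b∈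
  ... | inj₁ h′ with ∈.∈-map⁻ _ h′
  ...   | b , b∈ , refl = here refl , b∈

  fibres-Unique : ∀ {xs} → Unique xs → (∀ a → Unique (f a)) → Unique (fibres xs)
  fibres-Unique [] uf = []
  fibres-Unique {x ∷ xs} (x∉ ∷ u) uf = Unique.++⁺ (Unique.map⁺ (λ { refl → refl }) (uf x)) (fibres-Unique u uf)
    λ (h , h′) → let b , _ , eq = ∈.∈-map⁻ _ h in
      All.lookup x∉ (proj₁ (∈-fibres⁻ {xs} (subst (_∈ fibres xs) eq h′))) refl

map-Unique-on : ∀ {A B : Set} {P : A → Set} {f : A → B} {xs} → (∀ {x y} → P x → P y → f x ≡ f y → x ≡ y) →
  All P xs → Unique xs → Unique (map f xs)
map-Unique-on inj pxs u = AllPairs.map⁺ (AllPairs-map-All (λ px py x≢y eq → x≢y (inj px py eq)) pxs u)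

module _ {A : Set} {P Q R : A → Set} (P? : ∀ x → Dec (P x)) (Q? : ∀ x → Dec (Q x)) (R? : ∀ x → Dec (R x)) where

  length-filter₂ : (∀ {x} → P x → ¬ Q x) → ∀ xs → length (filter P? xs) + length (filter Q? xs) ≤ length xs
  length-filter₂ disj [] = z≤n
  length-filter₂ disj (x ∷ xs) with P? x | Q? x | length-filter₂ disj xs
  ... | yes p | yes q | _  = contradiction q (disj p)
  ... | yes _ | no _  | ih = s≤s ih
  ... | no _  | yes _ | ih = ≤-trans (≤-reflexive (+-suc _ _)) (s≤s ih)
  ... | no _  | no _  | ih = m≤n⇒m≤1+n ih

  private
    grow : ∀ xs i j k → 1 ≤ i + j + k →
      length xs ≤ length (filter P? xs) + length (filter Q? xs) + length (filter R? xs) →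
      suc (length xs) ≤ (i + length (filter P? xs)) + (j + length (filter Q? xs)) + (k + length (filter R? xs))
    grow xs i j k 1≤ le = ≤-trans (+-mono-≤ 1≤ le)
      (≤-reflexive (shuffle i j k (length (filter P? xs)) (length (filter Q? xs)) (length (filter R? xs))))
      where
      shuffle : ∀ i j k p q r → i + j + k + (p + q + r) ≡ (i + p) + (j + q) + (k + r)
      shuffle = solve-∀

  length-filter₃ : (∀ x → P x ⊎ Q x ⊎ R x) → ∀ xs →
    length xs ≤ length (filter P? xs) + length (filter Q? xs) + length (filter R? xs)
  length-filter₃ cover [] = z≤n
  length-filter₃ cover (x ∷ xs) with P? x | Q? x | R? x | length-filter₃ cover xs
  ... | no ¬p | no ¬q | no ¬r | _  = contradiction (cover x)
    λ { (inj₁ p) → ¬p p ; (inj₂ (inj₁ q)) → ¬q q ; (inj₂ (inj₂ r)) → ¬r r }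
  ... | yes _ | yes _ | yes _ | ih = grow xs 1 1 1 (s≤s z≤n) ih
  ... | yes _ | yes _ | no _  | ih = grow xs 1 1 0 (s≤s z≤n) ih
  ... | yes _ | no _  | yes _ | ih = grow xs 1 0 1 (s≤s z≤n) ih
  ... | yes _ | no _  | no _  | ih = grow xs 1 0 0 (s≤s z≤n) ih
  ... | no _  | yes _ | yes _ | ih = grow xs 0 1 1 (s≤s z≤n) ih
  ... | no _  | yes _ | no _  | ih = grow xs 0 1 0 (s≤s z≤n) ih
  ... | no _  | no _  | yes _ | ih = grow xs 0 0 1 (s≤s z≤n) ih

-- Pairs of 2-paths with a common end

module _ {n : ℕ} where

  -- The pair (u , y) stands for the 2-path v - u - y from a fixed vertex v.
  Pair : Set
  Pair = Fin n × Fin n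

  hits : Fin n → List Pair → List Pair
  hits y = filter λ (_ , y′) → y′ Fin.≟ y

  module _ (v : Fin n) where

    -- In `earlier` the list holds entries met before `(u , y)`, in `later` entries met after it.
    -- Both put the middle vertex met first into second place, so a pair of 2-paths gives the same
    -- quad from either side.
    earlier later : Pair → List Pair → List (Quad (Fin n))
    earlier (u , y) P = map (λ (x , _) → v , x , y , u) (hits y P)
    later   (u , y) P = map (λ (x , _) → v , u , y , x) (hits y P)

    pairs : List Pair → List (Quad (Fin n))
    pairs []      = []
    pairs (a ∷ P) = later a P ++ pairs P

    -- These are the pairs whose earlier member is among the first `k` entries. A pair thus belongs
    -- to exactly one pass, the one that stores its earlier member.
    firstPairs : ℕ → List Pair → List (Quad (Fin n))
    firstPairs zero    P       = []
    firstPairs (suc k) []      = []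
    firstPairs (suc k) (a ∷ P) = later a P ++ firstPairs k P

    pairs-split : ∀ k P → pairs P ≡ firstPairs k P ++ pairs (drop k P)
    pairs-split zero    P       = refl
    pairs-split (suc k) []      = refl
    pairs-split (suc k) (a ∷ P) =
      trans (cong (later a P ++_) (pairs-split k P)) (sym (List.++-assoc (later a P) _ _))

    crossPairs : List Pair → List Pair → List (Quad (Fin n))
    crossPairs buf = concatMap λ a → earlier a buf

    crossPairs-[] : ∀ P → crossPairs [] P ≡ []
    crossPairs-[] []      = refl
    crossPairs-[] (a ∷ P) = crossPairs-[] P

    -- The program lists matches by their later member, `pairs` by their earlier one. Pulling one
    -- buffered entry out of all the matches exchanges the two orders of summation.
    crossPairs-∷ : ∀ a buf P → crossPairs (a ∷ buf) P ↭ later a P ++ crossPairs buf P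
    crossPairs-∷ a buf [] = ↭-refl
    crossPairs-∷ a@(u , y) buf (b@(u′ , y′) ∷ P) with y Fin.≟ y′ | y′ Fin.≟ y
    ... | yes refl | yes _ = prep _ (↭-trans
            (++⁺ˡ (earlier b buf) (crossPairs-∷ a buf P)) (shifts (earlier b buf) (later a P)))
    ... | no _ | no _ =
            ↭-trans (++⁺ˡ (earlier b buf) (crossPairs-∷ a buf P)) (shifts (earlier b buf) (later a P))
    ... | yes eq | no ne = contradiction (sym eq) ne
    ... | no ne | yes eq = contradiction (sym eq) ne

    -- One pass of the algorithm over the 2-paths from v: the first lo of them
    -- are skipped, the next n are stored in the buffer, and each one that is
    -- not skipped is matched with the buffer.
    module _ (lo : ℕ) where

      Scan : Set
      Scan = ℕ × List Pair

      visit : Pair → Scan → Scan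
      visit a (i , buf) = suc i ,
        (ifᵇ does (i <? lo) then buf else (ifᵇ does (length buf <? n) then a ∷ buf else buf))

      found : Pair → Scan → List (Quad (Fin n))
      found a (i , buf) = ifᵇ does (i <? lo) then [] else earlier a buf

      visits : List Pair → Scan → Scan
      visits []      c = c
      visits (a ∷ P) c = visits P (visit a c)

      founds : List Pair → Scan → List (Quad (Fin n))
      founds []      c = []
      founds (a ∷ P) c = found a c ++ founds P (visit a c)

      visits-++ : ∀ P Q c → visits (P ++ Q) c ≡ visits Q (visits P c)
      visits-++ []      Q c = refl
      visits-++ (a ∷ P) Q c = visits-++ P Q (visit a c)

      founds-++ : ∀ P Q c → founds (P ++ Q) c ≡ founds P c ++ founds Q (visits P c)
      founds-++ []      Q c = refl
      founds-++ (a ∷ P) Q c =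
        trans (cong (found a c ++_) (founds-++ P Q _)) (sym (List.++-assoc (found a c) _ _))

      visits-count : ∀ P i buf → proj₁ (visits P (i , buf)) ≡ i + length P
      visits-count []      i buf = sym (+-identityʳ i)
      visits-count (a ∷ P) i buf = trans (visits-count P (suc i) _) (sym (+-suc i _))

      founds-skip : ∀ d P i → i + d ≡ lo → founds P (i , []) ≡ founds (drop d P) (lo , [])
      founds-skip zero    P       i eq = cong (λ j → founds P (j , [])) (trans (sym (+-identityʳ i)) eq)
      founds-skip (suc d) []      i eq = refl
      founds-skip (suc d) (a ∷ P) i eq
        rewrite dec-true (i <? lo) (≤-trans (m≤m+n (suc i) d) (≤-reflexive (trans (sym (+-suc i d)) eq)))
        = founds-skip d P (suc i) (trans (sym (+-suc i d)) eq)

      -- `k` is the number of free slots. An entry that is stored is matched with everything after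
      -- it, which is its share of `firstPairs`; the entries stored before contribute `crossPairs`.
      founds-pairs : ∀ k P i buf → lo ≤ i → k + length buf ≡ n →
                     founds P (i , buf) ↭ crossPairs buf P ++ firstPairs k P
      founds-pairs zero    [] i buf lo≤i eq = ↭-refl
      founds-pairs (suc k) [] i buf lo≤i eq = ↭-refl
      founds-pairs zero (a ∷ P) i buf lo≤i eq
        rewrite dec-false (i <? lo) (≤⇒≯ lo≤i) | dec-false (length buf <? n) (λ lt → <-irrefl eq lt) =
        ↭-trans (++⁺ˡ (earlier a buf) (founds-pairs zero P (suc i) buf (m≤n⇒m≤1+n lo≤i) eq))
                (↭-reflexive (sym (List.++-assoc (earlier a buf) _ _)))
      founds-pairs (suc k) (a ∷ P) i buf lo≤i eq
        rewrite dec-false (i <? lo) (≤⇒≯ lo≤i)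
              | dec-true (length buf <? n) (≤-trans (s≤s (m≤n+m _ k)) (≤-reflexive eq)) = begin
        earlier a buf ++ founds P (suc i , a ∷ buf)
          ↭⟨ ++⁺ˡ (earlier a buf) (founds-pairs k P (suc i) (a ∷ buf) (m≤n⇒m≤1+n lo≤i) (trans (+-suc k _) eq)) ⟩
        earlier a buf ++ (crossPairs (a ∷ buf) P ++ firstPairs k P)
          ↭⟨ ++⁺ˡ (earlier a buf) (++⁺ʳ (firstPairs k P) (crossPairs-∷ a buf P)) ⟩
        earlier a buf ++ ((later a P ++ crossPairs buf P) ++ firstPairs k P)
          ≡⟨ cong (earlier a buf ++_) (List.++-assoc (later a P) _ _) ⟩
        earlier a buf ++ (later a P ++ (crossPairs buf P ++ firstPairs k P))
          ↭⟨ ++⁺ˡ (earlier a buf) (shifts (later a P) (crossPairs buf P)) ⟩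
        earlier a buf ++ (crossPairs buf P ++ (later a P ++ firstPairs k P))
          ≡⟨ List.++-assoc (earlier a buf) _ _ ⟨
        (earlier a buf ++ crossPairs buf P) ++ (later a P ++ firstPairs k P) ∎
        where open PermutationReasoning

      founds-pass : ∀ P → founds P (0 , []) ↭ firstPairs n (drop lo P)
      founds-pass P = begin
        founds P (0 , [])                ≡⟨ founds-skip lo P 0 refl ⟩
        founds (drop lo P) (lo , [])     ↭⟨ founds-pairs n (drop lo P) lo [] ≤-refl (+-identityʳ n) ⟩
        crossPairs [] (drop lo P) ++ firstPairs n (drop lo P)
                                         ≡⟨ cong (_++ firstPairs n (drop lo P)) (crossPairs-[] (drop lo P)) ⟩
        firstPairs n (drop lo P)         ∎
        where open PermutationReasoning

-- A lower bound for the number of pairs, by sums of squares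

sum-bump : ∀ {n} (f g : Fin n → ℕ) y δ → g y ≡ f y + δ → (∀ z → z ≢ y → g z ≡ f z) →
           sum (tabulate g) ≡ sum (tabulate f) + δ
sum-bump f g Fin.zero δ on off =
  trans (cong₂ _+_ on (cong sum (List.tabulate-cong (λ z → off (Fin.suc z) λ ()))))
        (lemma (f Fin.zero) _ δ)
  where
  lemma : ∀ a b δ → (a + δ) + b ≡ (a + b) + δ
  lemma = solve-∀
sum-bump f g (Fin.suc y) δ on off =
  trans (cong₂ _+_ (off Fin.zero λ ())
          (sum-bump (f ∘ Fin.suc) (g ∘ Fin.suc) y δ on λ z z≢y → off (Fin.suc z) (z≢y ∘ Fin.suc-injective)))
        (sym (+-assoc (f Fin.zero) _ δ))

sum-tabulate-mono : ∀ {n} {f g : Fin n → ℕ} → (∀ z → f z ≤ g z) → sum (tabulate f) ≤ sum (tabulate g)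
sum-tabulate-mono {zero}  f≤g = z≤n
sum-tabulate-mono {suc n} f≤g = +-mono-≤ (f≤g Fin.zero) (sum-tabulate-mono (f≤g ∘ Fin.suc))

sum-tabulate-zero : ∀ n → sum (tabulate {n = n} λ _ → 0) ≡ 0
sum-tabulate-zero zero = refl
sum-tabulate-zero (suc n) = sum-tabulate-zero n

module _ {n : ℕ} (v : Fin n) where

  private
    tally : Fin n → List (Pair {n}) → ℕ
    tally y P = length (hits y P)

  tally-here : ∀ u y P → tally y ((u , y) ∷ P) ≡ suc (tally y P)
  tally-here u y P = cong length (List.filter-accept (λ a → proj₂ a Fin.≟ y) {xs = P} refl)

  tally-there : ∀ u {y z} P → z ≢ y → tally z ((u , y) ∷ P) ≡ tally z P
  tally-there u {z = z} P z≢y = cong length (List.filter-reject (λ a → proj₂ a Fin.≟ z) {xs = P} (z≢y ∘ sym))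

  -- One more entry with end `y` raises `tally y P` from t to t + 1. The squares then grow by 2 t +
  -- 1, while `pairs` gains the t matches of the new entry.
  sum-squares : ∀ q P → sum (tabulate λ y → 2 * q * tally y P) ≡ 2 * q * length P ×
                        sum (tabulate λ y → tally y P * tally y P + q * q)
                          ≡ 2 * length (pairs v P) + length P + n * (q * q)
  sum-squares q [] = trans (cong sum (List.tabulate-cong {n = n} λ _ → *-zeroʳ (2 * q)))
                           (trans (sum-tabulate-zero n) (sym (*-zeroʳ (2 * q)))) , const n
    where
    const : ∀ n → sum (tabulate {n = n} λ y → q * q) ≡ n * (q * q)
    const zero    = refl
    const (suc n) = cong (q * q +_) (const n)
  sum-squares q ((u , y) ∷ P) with sum-squares q P
  ... | lin , sq =
    trans (sum-bump (λ y → 2 * q * tally y P) _ y (2 * q)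
            (trans (cong (2 * q *_) (tally-here u y P)) (l₁ (2 * q) _))
            λ z z≢y → cong (2 * q *_) (tally-there u P z≢y))
          (trans (cong (_+ 2 * q) lin) (sym (l₁ (2 * q) _))) ,
    trans (sum-bump (λ y → tally y P * tally y P + q * q) _ y (2 * tally y P + 1)
            (trans (cong (λ t → t * t + q * q) (tally-here u y P)) (l₂ (tally y P) (q * q)))
            λ z z≢y → cong (λ t → t * t + q * q) (tally-there u P z≢y))
          (trans (cong (_+ (2 * tally y P + 1)) sq)
            (trans (l₃ (tally y P) (length (pairs v P)) _ _)
              (cong (λ t → 2 * t + suc (length P) + n * (q * q)) (sym count))))
    where
    l₁ : ∀ a t → a * suc t ≡ a * t + a
    l₁ = solve-∀
    l₂ : ∀ t b → suc t * suc t + b ≡ t * t + b + (2 * t + 1)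
    l₂ = solve-∀
    l₃ : ∀ t p l c → 2 * p + l + c + (2 * t + 1) ≡ 2 * (t + p) + suc l + c
    l₃ = solve-∀
    count : length (later v (u , y) P ++ pairs v P) ≡ tally y P + length (pairs v P)
    count = trans (List.length-++ (later v (u , y) P)) (cong (_+ length (pairs v P)) (List.length-map _ (hits y P)))

  -- The two sides differ by the square of the distance `d` between `q` and `c`; writing the larger
  -- number as the smaller plus `d` avoids truncated subtraction.
  2qc≤c²+q² : ∀ q c → 2 * q * c ≤ c * c + q * q
  2qc≤c²+q² q c with ≤-total q c
  ... | inj₁ q≤c with m≤n⇒∃[o]m+o≡n q≤c
  ...   | d , refl = ≤-trans (m≤m+n _ (d * d)) (≤-reflexive (square q d))
    where
    square : ∀ q d → 2 * q * (q + d) + d * d ≡ (q + d) * (q + d) + q * q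
    square = solve-∀
  2qc≤c²+q² q c | inj₂ c≤q with m≤n⇒∃[o]m+o≡n c≤q
  ...   | d , refl = ≤-trans (m≤m+n _ (d * d)) (≤-reflexive (square c d))
    where
    square : ∀ c d → 2 * (c + d) * c + d * d ≡ c * c + (c + d) * (c + d)
    square = solve-∀

  -- Moved to one side, this is Σ (c_y - q)² ≥ 0, where c_y counts the entries
  -- of P with second component y.
  pairs-bound : ∀ q P → 2 * q * length P ≤ 2 * length (pairs v P) + length P + n * (q * q)
  pairs-bound q P with sum-squares q P
  ... | lin , sq = ≤-trans (≤-reflexive (sym lin))
    (≤-trans (sum-tabulate-mono λ y → 2qc≤c²+q² q (tally y P)) (≤-reflexive sq))

-- Execution on a store of natural numbers

-- Registers hold plain numbers, so positions are numbers too; the bounds check needed to read the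
-- array is carried along as `index`.
record At {X : Set} (xs : List X) (i : ℕ) (x : X) : Set where
  constructor pos
  field
    index   : Fin (length xs)
    index≡  : toℕ index ≡ i
    lookup≡ : lookup xs index ≡ x

-- Neither word size nor array length appears here: both become side conditions of single steps in
-- `Evaluates` and `Exec`.
record Store (k a : ℕ) : Set where
  constructor store
  field
    R : Fin k → ℕ
    M : Fin a → ℕ → ℕ

open Store

module _ {k a : ℕ} where

  put : Fin k → ℕ → Store k a → Store k a
  put r x S = store (λ r′ → ifᵇ does (r′ Fin.≟ r) then x else R S r′) (M S)

  poke : Fin a → ℕ → ℕ → Store k a → Store k a
  poke A i x S = store (R S) λ A′ i′ →
    ifᵇ does (A′ Fin.≟ A) then (ifᵇ does (i′ ≟ i) then x else M S A′ i′) else M S A′ i′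

  ⟪_⟫ : Operand k → Store k a → ℕ
  ⟪ reg r ⟫ S = R S r
  ⟪ lit c ⟫ S = c

  True : Test k → Store k a → Set
  True (x == y) S = ⟪ x ⟫ S ≡ ⟪ y ⟫ S
  True (x << y) S = ⟪ x ⟫ S < ⟪ y ⟫ S

  -- A Boolean computed from the program text, so that the premise of a frame lemma is proved by
  -- `refl` for each concrete program.
  assigns : Fin k → Program k a → Bool
  assigns r skip                   = false
  assigns r (r′ := _)              = does (r Fin.≟ r′)
  assigns r (write _ at _ val _)   = false
  assigns r (emit _)               = false
  assigns r (p ⨾ q)                = assigns r p ∨ assigns r q
  assigns r (if _ then p else q)   = assigns r p ∨ assigns r q
  assigns r (while _ run p)        = assigns r p

  writes : Fin a → Program k a → Bool
  writes A skip                   = false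
  writes A (_ := _)               = false
  writes A (write A′ at _ val _)  = does (A Fin.≟ A′)
  writes A (emit _)               = false
  writes A (p ⨾ q)                = writes A p ∨ writes A q
  writes A (if _ then p else q)   = writes A p ∨ writes A q
  writes A (while _ run p)        = writes A p

module Semantics {n : ℕ} {G : Graph n} (L : AdjacencyLists G) {k a : ℕ} (s B : ℕ) where
  open AdjacencyLists L

  -- Only literals and sums carry the condition of fitting into a word. Any other value is already
  -- stored in one, or is bounded by `n` or by the length of the adjacency array.
  data Evaluates (S : Store k a) : Expr k a → ℕ → Set where
    copy      : ∀ {r} → Evaluates S (val (reg r)) (R S r)
    const     : ∀ {c} → c < B → Evaluates S (val (lit c)) c
    add       : ∀ {x y} → ⟪ x ⟫ S + ⟪ y ⟫ S < B → Evaluates S (x ⊕ y) (⟪ x ⟫ S + ⟪ y ⟫ S)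
    read      : ∀ {A x} → ⟪ x ⟫ S < s → Evaluates S (read A x) (M S A (⟪ x ⟫ S))
    sizeV     : Evaluates S sizeV n
    sizeAdj   : Evaluates S sizeAdj (length adj)
    readDeg   : ∀ {x} v → ⟪ x ⟫ S ≡ toℕ v → Evaluates S (readDeg x) (deg v)
    readStart : ∀ {x} v → ⟪ x ⟫ S ≡ toℕ v → Evaluates S (readStart x) (start v)
    readAdj   : ∀ {x v} → At adj (⟪ x ⟫ S) v → Evaluates S (readAdj x) (toℕ v)

  -- Unlike Run, the time is an upper bound and the output is up to order.
  data Exec : Program k a → Store k a → ℕ → List (Quad (Fin n)) → Store k a → Set where
    skip   : ∀ {S} → Exec skip S 1 [] S
    assign : ∀ {S r e x} → Evaluates S e x → Exec (r := e) S 1 [] (put r x S)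
    write  : ∀ {S A x r} → ⟪ x ⟫ S < s →
             Exec (write A at x val (reg r)) S 1 [] (poke A (⟪ x ⟫ S) (R S r) S)
    emit   : ∀ {S x₁ x₂ x₃ x₄} v₁ v₂ v₃ v₄ →
             ⟪ x₁ ⟫ S ≡ toℕ v₁ → ⟪ x₂ ⟫ S ≡ toℕ v₂ → ⟪ x₃ ⟫ S ≡ toℕ v₃ → ⟪ x₄ ⟫ S ≡ toℕ v₄ →
             Exec (emit (x₁ , x₂ , x₃ , x₄)) S 1 ((v₁ , v₂ , v₃ , v₄) ∷ []) S
    seq    : ∀ {S S′ S″ p q t u os os′} →
             Exec p S t os S′ → Exec q S′ u os′ S″ → Exec (p ⨾ q) S (t + u) (os ++ os′) S″
    ifTrue  : ∀ {S S′ b p q t os} → True b S → Exec p S t os S′ →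
              Exec (if b then p else q) S (suc t) os S′
    ifFalse : ∀ {S S′ b p q t os} → ¬ True b S → Exec q S t os S′ →
              Exec (if b then p else q) S (suc t) os S′
    whileTrue  : ∀ {S S′ S″ b p t u os os′} → True b S →
                 Exec p S t os S′ → Exec (while b run p) S′ u os′ S″ →
                 Exec (while b run p) S (suc (t + u)) (os ++ os′) S″
    whileFalse : ∀ {S b p} → ¬ True b S → Exec (while b run p) S 1 [] S
    weaken     : ∀ {S S′ p t t′ os os′} → t ≤ t′ → os ↭ os′ →
                 Exec p S t os S′ → Exec p S t′ os′ S′

  frameR : ∀ {p S t os S′} r → Exec p S t os S′ → assigns r p ≡ false → R S′ r ≡ R S r
  frameR r skip eq = refl
  frameR r (assign _) eq rewrite eq = refl
  frameR r (write _) eq = refl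
  frameR r (emit _ _ _ _ _ _ _ _) eq = refl
  frameR r (seq {p = p} {q} x y) eq =
    trans (frameR r y (∨-conicalʳ (assigns r p) _ eq)) (frameR r x (∨-conicalˡ _ _ eq))
  frameR r (ifTrue _ x) eq = frameR r x (∨-conicalˡ _ _ eq)
  frameR r (ifFalse {p = p} _ x) eq = frameR r x (∨-conicalʳ (assigns r p) _ eq)
  frameR r (whileTrue _ x y) eq = trans (frameR r y eq) (frameR r x eq)
  frameR r (whileFalse _) eq = refl
  frameR r (weaken _ _ x) eq = frameR r x eq

  frameM : ∀ {p S t os S′} A → Exec p S t os S′ → writes A p ≡ false → ∀ i → M S′ A i ≡ M S A i
  frameM A skip eq i = refl
  frameM A (assign _) eq i = refl
  frameM A (write _) eq i rewrite eq = refl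
  frameM A (emit _ _ _ _ _ _ _ _) eq i = refl
  frameM A (seq {p = p} {q} x y) eq i =
    trans (frameM A y (∨-conicalʳ (writes A p) _ eq) i) (frameM A x (∨-conicalˡ _ _ eq) i)
  frameM A (ifTrue _ x) eq i = frameM A x (∨-conicalˡ _ _ eq) i
  frameM A (ifFalse {p = p} _ x) eq i = frameM A x (∨-conicalʳ (writes A p) _ eq) i
  frameM A (whileTrue _ x y) eq i = trans (frameM A y eq i) (frameM A x eq i)
  frameM A (whileFalse _) eq i = refl
  frameM A (weaken _ _ x) eq i = frameM A x eq i

  record _≋_ (σ : State k a s B) (S : Store k a) : Set where
    constructor sync
    open State σ
    field
      regs≋ : ∀ r → toℕ (Vec.lookup regs r) ≡ R S r
      mems≋ : ∀ A i → toℕ (Vec.lookup (Vec.lookup arrays A) i) ≡ M S A (toℕ i)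

  open _≋_

  -- The value 0 beyond the end of an array is a default that no derivation of `Exec` reads, as its
  -- accesses stay below `s`.
  abstraction : State k a s B → Store k a
  abstraction σ = store (λ r → toℕ (Vec.lookup (State.regs σ) r)) cell
    where
    cell : Fin a → ℕ → ℕ
    cell A i with i <? s
    ... | yes i<s = toℕ (Vec.lookup (Vec.lookup (State.arrays σ) A) (fromℕ< i<s))
    ... | no _    = 0

  abstraction-≋ : ∀ σ → σ ≋ abstraction σ
  abstraction-≋ σ = sync (λ _ → refl) λ A i → cell≡ A i
    where
    cell≡ : ∀ A i → toℕ (Vec.lookup (Vec.lookup (State.arrays σ) A) i) ≡ M (abstraction σ) A (toℕ i)
    cell≡ A i with toℕ i <? s
    ... | yes i<s = cong (λ j → toℕ (Vec.lookup (Vec.lookup (State.arrays σ) A) j)) (sym (Fin.fromℕ<-toℕ i i<s))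
    ... | no i≮s  = contradiction (Fin.toℕ<n i) i≮s

  module _ (n<B : n < B) (adj<B : length adj < B)
           (seg≤ : ∀ v → start v + deg v ≤ length adj) where

    module _ {σ : State k a s B} {S : Store k a} (σ≋S : σ ≋ S) where

      ⟦⟧≡⟪⟫ : ∀ x → ⟦ x ⟧ σ ≡ ⟪ x ⟫ S
      ⟦⟧≡⟪⟫ (reg r) = regs≋ σ≋S r
      ⟦⟧≡⟪⟫ (lit c) = refl

      Holds⇒ : ∀ b → Holds b σ → True b S
      Holds⇒ (x == y) eq = trans (sym (⟦⟧≡⟪⟫ x)) (trans eq (⟦⟧≡⟪⟫ y))
      Holds⇒ (x << y) lt = subst₂ _<_ (⟦⟧≡⟪⟫ x) (⟦⟧≡⟪⟫ y) lt

      Holds⇐ : ∀ b → True b S → Holds b σ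
      Holds⇐ (x == y) eq = trans (⟦⟧≡⟪⟫ x) (trans eq (sym (⟦⟧≡⟪⟫ y)))
      Holds⇐ (x << y) lt = subst₂ _<_ (sym (⟦⟧≡⟪⟫ x)) (sym (⟦⟧≡⟪⟫ y)) lt

      eval : ∀ {e x} → Evaluates S e x → x < B × Eval L σ e x
      eval (copy {r}) =
        subst (_< B) (regs≋ σ≋S r) (Fin.toℕ<n _) , subst (Eval L σ _) (regs≋ σ≋S r) val
      eval (const c<B) = c<B , val
      eval (add {x} {y} lt) = lt , subst (Eval L σ _) (cong₂ _+_ (⟦⟧≡⟪⟫ x) (⟦⟧≡⟪⟫ y)) add
      eval (read {A} {x} lt) =
        subst (_< B) eq (Fin.toℕ<n _) ,
        subst (Eval L σ _) eq (read (fromℕ< lt) (trans (Fin.toℕ-fromℕ< lt) (sym (⟦⟧≡⟪⟫ x))))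
        where
        eq = trans (mems≋ σ≋S A (fromℕ< lt)) (cong (M S A) (Fin.toℕ-fromℕ< lt))
      eval sizeV   = n<B , sizeV
      eval sizeAdj = adj<B , sizeAdj
      eval (readDeg {x} v eq) =
        ≤-<-trans (m≤n+m _ _) (≤-<-trans (seg≤ v) adj<B) , readDeg v (trans (sym eq) (sym (⟦⟧≡⟪⟫ x)))
      eval (readStart {x} v eq) =
        ≤-<-trans (m≤m+n _ _) (≤-<-trans (seg≤ v) adj<B) , readStart v (trans (sym eq) (sym (⟦⟧≡⟪⟫ x)))
      eval (readAdj {x} {v} (pos p eq refl)) =
        <-trans (Fin.toℕ<n v) n<B , readAdj p (trans eq (sym (⟦⟧≡⟪⟫ x)))

      setReg-≋ : ∀ r {x} (w : Fin B) → toℕ w ≡ x → setReg r w σ ≋ put r x S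
      setReg-≋ r w eq = sync regs (mems≋ σ≋S)
        where
        regs : ∀ r′ → toℕ (Vec.lookup (State.regs σ Vec.[ r ]≔ w) r′) ≡ R (put r _ S) r′
        regs r′ with r′ Fin.≟ r
        ... | yes refl = trans (cong toℕ (Vec.lookup∘update r (State.regs σ) w)) eq
        ... | no r′≢r  = trans (cong toℕ (Vec.lookup∘update′ r′≢r (State.regs σ) w)) (regs≋ σ≋S r′)

      setCell-≋ : ∀ A i {x} (w : Fin B) → toℕ w ≡ x → setCell A i w σ ≋ poke A (toℕ i) x S
      setCell-≋ A i w eq = sync (regs≋ σ≋S) mems
        where
        old = State.arrays σ
        row = Vec.lookup old A Vec.[ i ]≔ w
        mems : ∀ A′ i′ → toℕ (Vec.lookup (Vec.lookup (old Vec.[ A ]≔ row) A′) i′)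
                         ≡ M (poke A (toℕ i) _ S) A′ (toℕ i′)
        mems A′ i′ with A′ Fin.≟ A
        ... | no A′≢A =
          trans (cong (λ z → toℕ (Vec.lookup z i′)) (Vec.lookup∘update′ A′≢A old row)) (mems≋ σ≋S A′ i′)
        ... | yes refl with toℕ i′ ≟ toℕ i
        ...   | yes eq′ rewrite Fin.toℕ-injective eq′ | dec-true (toℕ i ≟ toℕ i) refl =
          trans (cong (λ z → toℕ (Vec.lookup z i)) (Vec.lookup∘update A old row))
                (trans (cong toℕ (Vec.lookup∘update i (Vec.lookup old A) w)) eq)
        ...   | no i′≢i rewrite dec-false (toℕ i′ ≟ toℕ i) i′≢i =
          trans (cong (λ z → toℕ (Vec.lookup z i′)) (Vec.lookup∘update A old row))
                (trans (cong toℕ (Vec.lookup∘update′ (λ e → i′≢i (cong toℕ e)) (Vec.lookup old A) w))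
                       (mems≋ σ≋S A i′))

    -- The derivation is followed rule by rule. Only `weaken` has no counterpart in `Run`: there the
    -- true time and the true order of the output may depart from `t` and `os`.
    simulate : ∀ {p σ S t os S′} → σ ≋ S → Exec p S t os S′ →
               Σ[ t′ ∈ ℕ ] Σ[ os′ ∈ List (Quad (Fin n)) ] Σ[ σ′ ∈ State k a s B ]
                 Run L p σ t′ os′ σ′ × t′ ≤ t × os′ ↭ os × σ′ ≋ S′
    simulate ≋S skip = 1 , [] , _ , skip , ≤-refl , ↭-refl , ≋S
    simulate {σ = σ} ≋S (assign {r = r} ev) with eval ≋S ev
    ... | x<B , ev′ =
      1 , [] , setReg r (fromℕ< x<B) σ ,
      assign (fromℕ< x<B) (subst (Eval L σ _) (sym (Fin.toℕ-fromℕ< x<B)) ev′) ,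
      ≤-refl , ↭-refl , setReg-≋ ≋S r _ (Fin.toℕ-fromℕ< x<B)
    simulate {σ = σ} {S} ≋S (write {A = A} {x} {r} lt) =
      1 , [] , _ ,
      write (fromℕ< lt) (Vec.lookup (State.regs σ) r)
        (trans (Fin.toℕ-fromℕ< lt) (sym (⟦⟧≡⟪⟫ ≋S x))) refl ,
      ≤-refl , ↭-refl ,
      subst (λ i → setCell A (fromℕ< lt) _ σ ≋ poke A i _ S) (Fin.toℕ-fromℕ< lt)
        (setCell-≋ ≋S A (fromℕ< lt) _ (regs≋ ≋S r))
    simulate ≋S (emit {x₁ = x₁} {x₂} {x₃} {x₄} v₁ v₂ v₃ v₄ e₁ e₂ e₃ e₄) =
      1 , _ , _ ,
      emit v₁ v₂ v₃ v₄ (back x₁ e₁) (back x₂ e₂) (back x₃ e₃) (back x₄ e₄) ,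
      ≤-refl , ↭-refl , ≋S
      where
      back : ∀ x {w} → ⟪ x ⟫ _ ≡ w → w ≡ ⟦ x ⟧ _
      back x eq = trans (sym eq) (sym (⟦⟧≡⟪⟫ ≋S x))
    simulate ≋S (seq x y) with simulate ≋S x
    ... | _ , _ , _ , run₁ , le₁ , pe₁ , ≋S′ with simulate ≋S′ y
    ... | _ , _ , _ , run₂ , le₂ , pe₂ , ≋S″ =
      _ , _ , _ , seq run₁ run₂ , +-mono-≤ le₁ le₂ , ++⁺ pe₁ pe₂ , ≋S″
    simulate ≋S (ifTrue {b = b} h x) with simulate ≋S x
    ... | _ , _ , _ , ex , le , pe , ≋S′ =
      _ , _ , _ , ifTrue (Holds⇐ ≋S b h) ex , s≤s le , pe , ≋S′
    simulate ≋S (ifFalse {b = b} h x) with simulate ≋S x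
    ... | _ , _ , _ , ex , le , pe , ≋S′ =
      _ , _ , _ , ifFalse (λ h′ → h (Holds⇒ ≋S b h′)) ex , s≤s le , pe , ≋S′
    simulate ≋S (whileTrue {b = b} h x y) with simulate ≋S x
    ... | _ , _ , _ , run₁ , le₁ , pe₁ , ≋S′ with simulate ≋S′ y
    ... | _ , _ , _ , run₂ , le₂ , pe₂ , ≋S″ =
      _ , _ , _ , whileTrue (Holds⇐ ≋S b h) run₁ run₂ , s≤s (+-mono-≤ le₁ le₂) , ++⁺ pe₁ pe₂ , ≋S″
    simulate ≋S (whileFalse {b = b} h) =
      _ , _ , _ , whileFalse (λ h′ → h (Holds⇒ ≋S b h′)) , ≤-refl , ↭-refl , ≋S
    simulate ≋S (weaken le′ pe′ x) with simulate ≋S x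
    ... | _ , _ , _ , ex , le , pe , ≋S′ =
      _ , _ , _ , ex , ≤-trans le le′ , ↭-trans pe pe′ , ≋S′

-- The program

Prog : Set
Prog = Program 24 4

-- The lists of v and u are the segments from rA to rE and from rG to rH of the
-- adjacency array, with rJ and the increasing rG as cursors. In the current pass
-- rIdx 2-paths have been met and rK stored, and the first rLo are skipped.
rI rLen rNN rV rA rDv rW rB rC rLo rIdx rK rJ rE rU rDu rG rH rY rDy rP₀ rP rQ rX : Fin 24
rI   = # 0
rLen = # 1
rNN  = # 2
rV   = # 3
rA   = # 4
rDv  = # 5
rW   = # 6
rB   = # 7
rC   = # 8
rLo  = # 9
rIdx = # 10
rK   = # 11
rJ   = # 12
rE   = # 13
rU   = # 14
rDu  = # 15
rG   = # 16
rH   = # 17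
rY   = # 18
rDy  = # 19
rP₀  = # 20
rP   = # 21
rQ   = # 22
rX   = # 23

aHead aKey aItem aNext : Fin 4
aHead = # 0
aKey  = # 1
aItem = # 2
aNext = # 3

ifBelow : Fin 24 → Fin 24 → Prog → Prog
ifBelow x dx p =
  if reg dx << reg rDv then p else
  if reg dx == reg rDv then (if reg x << reg rV then p else skip) else skip

findLast walk push match visitPair visitY visitU pass passes visitV visitI main : Prog

findLast =
  rP₀ := read aHead (reg rY) ⨾
  -- The head cell may never have been written. Its content is trusted only if it is a slot in use
  -- whose key is `rY`; otherwise the null pointer `rNN` replaces it.
  if reg rP₀ << reg rK
    then (rQ := read aKey (reg rP₀) ⨾
          if reg rQ == reg rY then skip else (rP₀ := val (reg rNN)))
    else (rP₀ := val (reg rNN))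

walk =
  while reg rP << reg rNN run
    (rX := read aItem (reg rP) ⨾
     emit (reg rV , reg rX , reg rY , reg rU) ⨾
     rP := read aNext (reg rP))

push =
  if reg rK << reg rNN
    then (write aNext at reg rK val reg rP₀ ⨾
          write aItem at reg rK val reg rU ⨾
          write aKey at reg rK val reg rY ⨾
          write aHead at reg rY val reg rK ⨾
          rK := (reg rK ⊕ lit 1))
    else skip

-- `walk` uses up `rP`, while `rP₀` keeps the previous last slot for the link written by `push`.
-- Storing after matching prevents an entry from meeting itself.
match = findLast ⨾ rP := val (reg rP₀) ⨾ walk ⨾ push

visitPair =
  (if reg rIdx << reg rLo then skip else match) ⨾
  rIdx := (reg rIdx ⊕ lit 1)

visitY =
  rY := readAdj (reg rG) ⨾
  rDy := readDeg (reg rY) ⨾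
  ifBelow rY rDy visitPair ⨾
  rG := (reg rG ⊕ lit 1)

visitU =
  rU := readAdj (reg rJ) ⨾
  rDu := readDeg (reg rU) ⨾
  ifBelow rU rDu
    (rG := readStart (reg rU) ⨾
     rH := (reg rG ⊕ reg rDu) ⨾
     while reg rG << reg rH run visitY) ⨾
  rJ := (reg rJ ⊕ lit 1)

pass =
  rIdx := val (lit 0) ⨾
  rK := val (lit 0) ⨾
  rJ := val (reg rA) ⨾
  (while reg rJ << reg rE run visitU) ⨾
  rLo := (reg rLo ⊕ reg rNN)

passes = while reg rLo << reg rIdx run pass

visitV =
  rE := (reg rA ⊕ reg rDv) ⨾
  rLo := val (lit 0) ⨾
  -- The value 1 only makes the guard of `passes` true at first: the number of 2-paths is not known
  -- before one pass has counted them.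
  rIdx := val (lit 1) ⨾
  passes

visitI =
  rV := readAdj (reg rI) ⨾
  rA := readStart (reg rV) ⨾
  rDv := readDeg (reg rV) ⨾
  rW := readAdj (reg rA) ⨾
  rB := readStart (reg rW) ⨾
  rC := readDeg (reg rW) ⨾
  rC := (reg rB ⊕ reg rC) ⨾
  -- `rB` and `rC` delimit the list of the first neighbour `rW` of `rV`; of all occurrences of `rV`
  -- in the array, only the one in that list is processed.
  (if reg rI << reg rB then skip else
   if reg rI << reg rC then visitV else skip) ⨾
  rI := (reg rI ⊕ lit 1)

main =
  rI := val (lit 0) ⨾
  rLen := sizeAdj ⨾
  rNN := sizeV ⨾
  while reg rI << reg rLen run visitI

data Seg {X : Set} (Pos : ℕ → X → Set) : ℕ → List X → Set where
  []  : ∀ {i} → Seg Pos i []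
  _∷_ : ∀ {i x xs} → Pos i x → Seg Pos (suc i) xs → Seg Pos i (x ∷ xs)

module Loops {n : ℕ} {G : Graph n} (L : AdjacencyLists G) (B : ℕ) where
  open AdjacencyLists L
  open Semantics L {24} {4} n B public
  open Store public

  -- `c : C` is a ghost state tied to the store by `Inv`. The time of an iteration is split into a
  -- part fixed by the element and `K` per emitted quad, so that both parts add up separately. The
  -- scans have `K = 4`, the cost of an emission in `walk`; the outermost loop has `K = 0`, emission
  -- being part of its budget.
  module Loop {X C : Set} (Pos : ℕ → X → Set) (Inv : C → Store 24 4 → Set)
              (step : X → C → C) (out : X → C → List (Quad (Fin n)))
              (cost : X → ℕ) (K : ℕ) (j e : Fin 24) (body : Prog) where

    steps : List X → C → C
    steps []       c = c
    steps (x ∷ xs) c = steps xs (step x c)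

    outs : List X → C → List (Quad (Fin n))
    outs []       c = []
    outs (x ∷ xs) c = out x c ++ outs xs (step x c)

    Iterates : Set
    Iterates = ∀ {x c S} → Inv c S → Pos (R S j) x → R S j < R S e →
      Σ[ S′ ∈ Store 24 4 ] Exec body S (cost x + K * length (out x c)) (out x c) S′ ×
        Inv (step x c) S′ × R S′ j ≡ suc (R S j) × R S′ e ≡ R S e

    loop : Iterates → ∀ xs {c S} → Inv c S → Seg Pos (R S j) xs → R S e ≡ R S j + length xs →
      Σ[ S′ ∈ Store 24 4 ]
        Exec (while reg j << reg e run body) S
             (1 + sum (map (suc ∘ cost) xs) + K * length (outs xs c)) (outs xs c) S′ ×
        Inv (steps xs c) S′
    loop it [] {c} {S} inv [] eq =
      S , weaken (s≤s z≤n) ↭-refl (whileFalse λ lt → <-irrefl (sym (trans eq (+-identityʳ _))) lt) , inv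
    loop it (x ∷ xs) {c} {S} inv (px ∷ seg) eq
      with it inv px (≤-trans (m≤m+n (suc (R S j)) (length xs)) (≤-reflexive (trans (sym (+-suc _ _)) (sym eq))))
    ... | S₁ , ex₁ , inv₁ , j₁ , e₁
      with loop it xs inv₁ (subst (λ i → Seg Pos i xs) (sym j₁) seg)
             (trans e₁ (trans eq (trans (+-suc _ _) (cong (_+ length xs) (sym j₁)))))
    ... | S₂ , ex₂ , inv₂ =
      S₂ , weaken (≤-reflexive (trans (time (cost x) K _ _ _)
             (cong (λ l → 1 + (suc (cost x) + sum (map (suc ∘ cost) xs)) + K * l)
               (sym (List.length-++ (out x c))))))
             ↭-refl
             (whileTrue (≤-trans (m≤m+n (suc (R S j)) (length xs)) (≤-reflexive (trans (sym (+-suc _ _)) (sym eq)))) ex₁ ex₂) ,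
           inv₂
      where
      time : ∀ c K o s o′ → suc ((c + K * o) + (1 + s + K * o′)) ≡ 1 + (suc c + s) + K * (o + o′)
      time = solve-∀

-- The adjacency array

module _ {X : Set} where

  At-++ : ∀ xs {ys} {i} {x : X} → At ys i x → At (xs ++ ys) (length xs + i) x
  At-++ []       h = h
  At-++ (_ ∷ xs) h with At-++ xs h
  ... | pos p eq look = pos (Fin.suc p) (cong suc eq) look

  At-++ˡ : ∀ {xs} ys {i} {x : X} → At xs i x → At (xs ++ ys) i x
  At-++ˡ {_ ∷ _} ys (pos Fin.zero eq look) = pos Fin.zero eq look
  At-++ˡ {_ ∷ xs} ys (pos (Fin.suc p) refl look) with At-++ˡ {xs} ys (pos p refl look)
  ... | pos q eq look′ = pos (Fin.suc q) (cong suc eq) look′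

  At-functional : ∀ {xs i} {x y : X} → At xs i x → At xs i y → x ≡ y
  At-functional (pos p p≡ refl) (pos q q≡ refl) with Fin.toℕ-injective (trans p≡ (sym q≡))
  ... | refl = refl

  At-injective : ∀ {xs i j} {x : X} → Unique xs → At xs i x → At xs j x → i ≡ j
  At-injective {x ∷ xs} (x∉ ∷ u) (pos Fin.zero refl refl) (pos Fin.zero refl _) = refl
  At-injective {x ∷ xs} (x∉ ∷ u) (pos Fin.zero refl refl) (pos (Fin.suc q) refl eq) =
    contradiction (sym eq) (All.lookup x∉ (∈.∈-lookup q))
  At-injective {x ∷ xs} (x∉ ∷ u) (pos (Fin.suc p) refl eq) (pos Fin.zero refl refl) =
    contradiction (sym eq) (All.lookup x∉ (∈.∈-lookup p))
  At-injective {x ∷ xs} (x∉ ∷ u) (pos (Fin.suc p) refl eq) (pos (Fin.suc q) refl eq′) =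
    cong suc (At-injective u (pos p refl eq) (pos q refl eq′))

  ∈⇒At : ∀ {xs} {x : X} → x ∈ xs → Σ[ i ∈ ℕ ] i < length xs × At xs i x
  ∈⇒At x∈ = toℕ (Any.index x∈) , Fin.toℕ<n _ , pos (Any.index x∈) refl (sym (lookup-index x∈))
    where
    lookup-index : ∀ {xs} {x : X} (p : x ∈ xs) → x ≡ lookup xs (Any.index p)
    lookup-index (here eq) = eq
    lookup-index (there p) = lookup-index p

  At-all : ∀ {Pos : ℕ → X → Set} {j} xs → (∀ {i x} → At xs i x → Pos (j + i) x) → Seg Pos j xs
  At-all [] h = []
  At-all {Pos} {j} (x ∷ xs) h =
    subst (λ i → Pos i x) (+-identityʳ j) (h (pos Fin.zero refl refl)) ∷
    At-all xs λ {i} {y} (pos p eq look) → subst (λ k → Pos k y) (+-suc j i) (h (pos (Fin.suc p) (cong suc eq) look))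

Seg-tabulate : ∀ {m} {X : Set} {Pos : ℕ → X → Set} {j} (f : Fin m → X) →
  (∀ i → Pos (j + toℕ i) (f i)) → Seg Pos j (tabulate f)
Seg-tabulate {zero}  f h = []
Seg-tabulate {suc m} {Pos = Pos} {j} f h = subst (λ i → Pos i _) (+-identityʳ j) (h Fin.zero) ∷
  Seg-tabulate (f ∘ Fin.suc) λ i → subst (λ k → Pos k (f (Fin.suc i))) (+-suc j (toℕ i)) (h (Fin.suc i))

tabulate-split : ∀ {n} {X : Set} (f : Fin n → X) i →
  tabulate f ≡ take (toℕ i) (tabulate f) ++ f i ∷ drop (suc (toℕ i)) (tabulate f)
tabulate-split f Fin.zero    = refl
tabulate-split f (Fin.suc i) = cong (f Fin.zero ∷_) (tabulate-split (f ∘ Fin.suc) i)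

module Adjacency {n : ℕ} {G : Graph n} (L : AdjacencyLists G) where
  open AdjacencyLists L

  private
    before after : Fin n → List (Fin n)
    before v = concatMap nbrs (take (toℕ v) (allFin n))
    after  v = concatMap nbrs (drop (suc (toℕ v)) (allFin n))

    adj-split : ∀ v → adj ≡ before v ++ nbrs v ++ after v
    adj-split v = trans (cong (concatMap nbrs) (tabulate-split (λ i → i) v))
                        (List.concatMap-++ nbrs (take (toℕ v) (allFin n)) _)

    length-before : ∀ v → length (before v) ≡ start v
    length-before v = length-concatMap nbrs (take (toℕ v) (allFin n))

  nbrs-At : ∀ {v i u} → At (nbrs v) i u → At adj (start v + i) u
  nbrs-At {v} {i} {u} h = subst₂ (λ xs s → At xs (s + i) u) (sym (adj-split v)) (length-before v)
    (At-++ (before v) (At-++ˡ (after v) h))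

  segment : ∀ v → Seg (At adj) (start v) (nbrs v)
  segment v = At-all (nbrs v) nbrs-At

  segment≤ : ∀ v → start v + deg v ≤ length adj
  segment≤ v = begin
    start v + deg v                                       ≤⟨ +-monoʳ-≤ (start v) (m≤m+n (deg v) _) ⟩
    start v + (deg v + length (after v))                  ≡⟨ cong₂ _+_ (length-before v) (List.length-++ (nbrs v)) ⟨
    length (before v) + length (nbrs v ++ after v)        ≡⟨ List.length-++ (before v) ⟨
    length (before v ++ nbrs v ++ after v)                ≡⟨ cong length (adj-split v) ⟨
    length adj                                            ∎
    where open ≤-Reasoning hiding (start)

  deg≤n : ∀ v → deg v ≤ n
  deg≤n v = subst (deg v ≤_) (List.length-tabulate _) (length-≤-⊆ (unique v) λ {x} _ → ∈.∈-allFin x)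

  length-adj : length adj ≡ sum (map deg (allFin n))
  length-adj = length-concatMap nbrs (allFin n)

  length-adj≤ : length adj ≤ n * n
  length-adj≤ = begin
    length adj                        ≡⟨ length-adj ⟩
    sum (map deg (allFin n))          ≤⟨ sum-map-mono (allFin n) (λ {v} _ → ≤-trans (deg≤n v) (≤-reflexive (sym (*-identityʳ n)))) ⟩
    sum (map (λ _ → n * 1) (allFin n)) ≡⟨ sum-map-* n (λ _ → 1) (allFin n) ⟩
    n * sum (map (λ _ → 1) (allFin n)) ≡⟨ cong (n *_) (trans (sym (length-sum (allFin n))) (List.length-tabulate {n = n} _)) ⟩
    n * n                             ∎
    where open ≤-Reasoning hiding (start)

  nbr-sym : ∀ {u v} → u ∈ nbrs v → v ∈ nbrs u
  nbr-sym {u} {v} u∈ = Equivalence.from (spec u v) (Graph.sym G (Equivalence.to (spec v u) u∈))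

  -- A vertex v with a neighbour is processed at the one position where it
  -- occurs in the list of its own first neighbour.
  Owner : Fin n → Fin n → Set
  Owner v w = At adj (start v) w × v ∈ nbrs w

  adj-nonisolated : ∀ p → Σ[ w ∈ Fin n ] w ∈ nbrs (lookup adj p)
  adj-nonisolated p with Any.satisfied (∈.∈-concatMap⁻ nbrs {xs = allFin n} (∈.∈-lookup {xs = adj} p))
  ... | w , v∈ = w , nbr-sym v∈

  owner : ∀ {v w} → w ∈ nbrs v → Σ[ w ∈ Fin n ] Owner v w
  owner {v} {w} w∈ with nbrs v in eq
  ... | x ∷ xs = x , subst (λ i → At adj i x) (+-identityʳ (start v)) (nbrs-At (subst (λ ys → At ys 0 x) (sym eq) (pos Fin.zero refl refl))) ,
                 nbr-sym (subst (x ∈_) (sym eq) (here refl))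

  ownerAt : Fin (length adj) → Fin n
  ownerAt p = proj₁ (owner (proj₂ (adj-nonisolated p)))

  ownerAt-Owner : ∀ p → Owner (lookup adj p) (ownerAt p)
  ownerAt-Owner p = proj₂ (owner (proj₂ (adj-nonisolated p)))

  Chosen : Fin (length adj) → Set
  Chosen p = start (ownerAt p) ≤ toℕ p × toℕ p < start (ownerAt p) + deg (ownerAt p)

  Chosen? : ∀ p → Dec (Chosen p)
  Chosen? p = (start (ownerAt p) ≤? toℕ p) ×-dec (toℕ p <? start (ownerAt p) + deg (ownerAt p))

  chosen : List (Fin n)
  chosen = map (lookup adj) (filter Chosen? (allFin (length adj)))

  private
    within : ∀ {w p} → start w ≤ p → p < start w + deg w → Σ[ i ∈ ℕ ] i < deg w × p ≡ start w + i
    within {w} {p} s≤p p< with m≤n⇒∃[o]m+o≡n s≤p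
    ... | i , refl = i , +-cancelˡ-< (start w) i (deg w) p< , refl

    At-nbrs : ∀ {w i u} → i < deg w → At adj (start w + i) u → At (nbrs w) i u
    At-nbrs {w} {i} {u} i< at′ = subst (At (nbrs w) i) (At-functional (nbrs-At h) at′) h
      where
      h : At (nbrs w) i (lookup (nbrs w) (fromℕ< i<))
      h = pos (fromℕ< i<) (Fin.toℕ-fromℕ< i<) refl

    -- Positions of the same vertex have the same owner, as the array has one entry at the start of
    -- the vertex's list. Both then lie in the list of that owner, which has no repetitions.
    chosen-injective : ∀ {p q} → Chosen p → Chosen q → lookup adj p ≡ lookup adj q → p ≡ q
    chosen-injective {p} {q} (lo , hi) (lo′ , hi′) eq
      with At-functional (proj₁ (ownerAt-Owner p)) (subst (λ v → At adj (start v) (ownerAt q)) (sym eq) (proj₁ (ownerAt-Owner q)))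
    ... | same with within {ownerAt p} lo hi | within {ownerAt p} (subst (λ w → start w ≤ toℕ q) (sym same) lo′)
                                                 (subst (λ w → toℕ q < start w + deg w) (sym same) hi′)
    ... | i , i< , p≡ | j , j< , q≡ = Fin.toℕ-injective (trans p≡ (trans (cong (start (ownerAt p) +_)
            (At-injective (unique (ownerAt p)) (At-nbrs i< (pos p p≡ refl)) (At-nbrs j< (pos q q≡ (sym eq))))) (sym q≡)))

  chosen-Unique : Unique chosen
  chosen-Unique = map-Unique-on chosen-injective (All.all-filter Chosen? (allFin (length adj)))
    (Unique.filter⁺ Chosen? (Unique.allFin⁺ (length adj)))

  ∈-chosen : ∀ {v w} → w ∈ nbrs v → v ∈ chosen
  ∈-chosen {v} w∈ with owner w∈
  ... | x , first , v∈ with ∈⇒At v∈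
  ... | i , i< , h with nbrs-At h
  ... | pos p p≡ refl = ∈.∈-map⁺ (lookup adj) (∈.∈-filter⁺ Chosen? (∈.∈-allFin p) chosen-p)
    where
    same : x ≡ ownerAt p
    same = At-functional first (proj₁ (ownerAt-Owner p))
    chosen-p : Chosen p
    chosen-p = subst (λ w → start w ≤ toℕ p × toℕ p < start w + deg w) same
      (subst (start x ≤_) (sym p≡) (m≤m+n _ _) , subst (_< start x + deg x) (sym p≡) (+-monoʳ-< (start x) i<))

-- The degree order and the 2-paths from a vertex

module DegreeOrder {n : ℕ} {G : Graph n} (L : AdjacencyLists G) where
  open AdjacencyLists L

  -- The lexicographic order of degree and name, encoded in base `n`, which is possible because
  -- names are below `n`.
  rank : Fin n → ℕ
  rank u = deg u * n + toℕ u

  infix 4 _≺_ _≺?_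

  _≺_ : Fin n → Fin n → Set
  u ≺ v = rank u < rank v

  _≺?_ : ∀ u v → Dec (u ≺ v)
  u ≺? v = rank u <? rank v

  deg<⇒≺ : ∀ {u v} → deg u < deg v → u ≺ v
  deg<⇒≺ {u} {v} lt = begin-strict
    deg u * n + toℕ u <⟨ +-monoʳ-< (deg u * n) (Fin.toℕ<n u) ⟩
    deg u * n + n     ≡⟨ +-comm (deg u * n) n ⟩
    suc (deg u) * n   ≤⟨ *-monoˡ-≤ n lt ⟩
    deg v * n         ≤⟨ m≤m+n _ _ ⟩
    deg v * n + toℕ v ∎
    where open ≤-Reasoning

  ≺⇒deg≤ : ∀ {u v} → u ≺ v → deg u ≤ deg v
  ≺⇒deg≤ {u} {v} u≺v with deg u ≤? deg v
  ... | yes le = le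
  ... | no nle = contradiction (deg<⇒≺ {v} {u} (≰⇒> nle)) (<-asym u≺v)

  ≺-tie : ∀ {u v} → deg u ≡ deg v → u ≺ v → toℕ u < toℕ v
  ≺-tie {u} {v} eq lt rewrite eq = +-cancelˡ-< (deg v * n) _ _ lt

  tie-≺ : ∀ {u v} → deg u ≡ deg v → toℕ u < toℕ v → u ≺ v
  tie-≺ {u} {v} eq lt rewrite eq = +-monoʳ-< (deg v * n) lt

  -- The conditionals mirror the branches of `visitU` and `visitY`, so that loops produce these
  -- lists literally; `P-fibres` later turns them into filters. The condition `Q` on the end is left
  -- open to cover low and high paths alike.
  module TwoPaths (v : Fin n) {Q : Fin n → Set} (Q? : ∀ y → Dec (Q y)) where

    pathsVia : Fin n → Fin n → List (Pair {n})
    pathsVia u y = ifᵇ does (Q? y) then (u , y) ∷ [] else []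

    paths : Fin n → List (Pair {n})
    paths u = ifᵇ does (u ≺? v) then concatMap (pathsVia u) (nbrs u) else []

    twoPaths : List (Pair {n})
    twoPaths = concatMap paths (nbrs v)

  lowPaths highPaths : Fin n → List (Pair {n})
  lowPaths  v = TwoPaths.twoPaths v (_≺? v)
  highPaths v = TwoPaths.twoPaths v (v ≺?_)

  cycles : Fin n → List (Quad (Fin n))
  cycles v = pairs v (lowPaths v)

-- Correctness of the program

module Correctness {n : ℕ} {G : Graph n} (L : AdjacencyLists G) (B : ℕ)
                    (fits : n * length (AdjacencyLists.adj L) + length (AdjacencyLists.adj L) + n + 1 < B) where
  open AdjacencyLists L
  open Loops L B
  open DegreeOrder L
  open Adjacency L

  1<B : 1 < B
  1<B = ≤-<-trans (m≤n+m 1 _) fits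

  -- All sums formed by the program are of this size: counts of 2-paths are at most
  -- `n * length adj`, array positions at most `length adj`, and only `n` or 1 is added to them.
  small : ∀ {x} → x ≤ n * length adj + length adj + n + 1 → x < B
  small le = ≤-<-trans le fits

  module _ {x dx : Fin 24} {p : Prog} {S : Store 24 4} {u v : Fin n}
           (xᵉ : R S x ≡ toℕ u) (dxᵉ : R S dx ≡ deg u) (vᵉ : R S rV ≡ toℕ v) (dvᵉ : R S rDv ≡ deg v) where

    ifBelow-yes : u ≺ v → ∀ {t os S′} → Exec p S t os S′ → Exec (ifBelow x dx p) S (3 + t) os S′
    ifBelow-yes u≺v ex with deg u <? deg v
    ... | yes lt = weaken (m≤n+m _ 2) ↭-refl (ifTrue (subst₂ _<_ (sym dxᵉ) (sym dvᵉ) lt) ex)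
    ... | no ¬lt = ifFalse (λ lt → ¬lt (subst₂ _<_ dxᵉ dvᵉ lt))
                     (ifTrue (trans dxᵉ (trans eq (sym dvᵉ)))
                       (ifTrue (subst₂ _<_ (sym xᵉ) (sym vᵉ) (≺-tie eq u≺v)) ex))
      where
      eq : deg u ≡ deg v
      eq = ≤-antisym (≺⇒deg≤ u≺v) (≮⇒≥ ¬lt)

    ifBelow-no : ¬ u ≺ v → Exec (ifBelow x dx p) S 4 [] S
    ifBelow-no ¬u≺v with deg u ≟ deg v
    ... | yes eq = ifFalse (<-irrefl (trans dxᵉ (trans eq (sym dvᵉ))))
                     (ifTrue (trans dxᵉ (trans eq (sym dvᵉ)))
                       (ifFalse (λ lt → ¬u≺v (tie-≺ eq (subst₂ _<_ xᵉ vᵉ lt))) skip))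
    ... | no ¬eq = weaken (n≤1+n 3) ↭-refl
                     (ifFalse (λ lt → ¬u≺v (deg<⇒≺ (subst₂ _<_ dxᵉ dvᵉ lt)))
                       (ifFalse (λ eq → ¬eq (trans (sym dxᵉ) (trans eq dvᵉ))) skip))

  -- The buffer is a family of linked lists, one for each y, threaded through the
  -- slots 0, ..., k-1; the slot of an entry is the number of older entries, and
  -- n is the null pointer.
  lastSlot : Fin n → List (Pair {n}) → ℕ
  lastSlot y []              = n
  lastSlot y ((_ , y′) ∷ b) = ifᵇ does (y′ Fin.≟ y) then length b else lastSlot y b

  Slots : (Fin 4 → ℕ → ℕ) → List (Pair {n}) → Set
  Slots m []            = ⊤
  Slots m ((u , y) ∷ b) =
    m aItem (length b) ≡ toℕ u × m aKey (length b) ≡ toℕ y × m aNext (length b) ≡ lastSlot y b × Slots m b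

  -- For y without entries the head may hold garbage, even a used slot: it is
  -- recognised by the key of that slot, so the array never needs clearing.
  Heads : (Fin 4 → ℕ → ℕ) → List (Pair {n}) → Set
  Heads m b = ∀ y → lastSlot y b < n → m aHead (toℕ y) ≡ lastSlot y b

  lastSlot-key : ∀ {m} y b → Slots m b → lastSlot y b < n →
                 lastSlot y b < length b × m aKey (lastSlot y b) ≡ toℕ y
  lastSlot-key y [] sl lt = contradiction lt (<-irrefl refl)
  lastSlot-key y ((u , y′) ∷ b) (_ , key , _ , sl) lt with y′ Fin.≟ y
  ... | yes refl = n<1+n _ , key
  ... | no _ with lastSlot-key y b sl lt
  ...   | lt′ , key′ = m<n⇒m<1+n lt′ , key′

  -- A used slot with key `y`, wherever its number was found, shows that `y` has an entry. Then
  -- `Heads` applies and the head of `y` is genuine, so garbage that passes the test of `findLast`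
  -- does no harm.
  key-lastSlot : ∀ {m} y b h → Slots m b → h < length b → m aKey h ≡ toℕ y → length b ≤ n → lastSlot y b < n
  key-lastSlot y ((u , y′) ∷ b) h (_ , key , _ , sl) lt eq le with y′ Fin.≟ y
  ... | yes _ = le
  ... | no y′≢y with h ≟ length b
  ...   | yes refl = contradiction (Fin.toℕ-injective (trans (sym key) eq)) y′≢y
  ...   | no h≢ = key-lastSlot y b h sl (≤∧≢⇒< (s≤s⁻¹ lt) h≢) eq (≤-trans (n≤1+n _) le)

  Slots-cong : ∀ {m m′} b → (∀ A i → A ≢ aHead → i < length b → m′ A i ≡ m A i) → Slots m b → Slots m′ b
  Slots-cong [] same sl = tt
  Slots-cong ((u , y) ∷ b) same (i , k , x , sl) =
    trans (same aItem _ (λ ()) ≤-refl) i , trans (same aKey _ (λ ()) ≤-refl) k ,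
    trans (same aNext _ (λ ()) ≤-refl) x , Slots-cong b (λ A j A≢ lt → same A j A≢ (m<n⇒m<1+n lt)) sl

  record Buffer (S : Store 24 4) (b : List (Pair {n})) : Set where
    field
      kᵉ    : R S rK ≡ length b
      fit   : length b ≤ n
      slots : Slots (M S) b
      heads : Heads (M S) b

  open Buffer

  lastSlot-≤ : ∀ y b → length b ≤ n → lastSlot y b ≤ n
  lastSlot-≤ y [] le = ≤-refl
  lastSlot-≤ y ((u , y′) ∷ b) le with y′ Fin.≟ y
  ... | yes _ = ≤-trans (n≤1+n _) le
  ... | no _  = lastSlot-≤ y b (≤-trans (n≤1+n _) le)

  module _ {S : Store 24 4} {b : List (Pair {n})} {y : Fin n} (buf : Buffer S b) (nᵉ : R S rNN ≡ n) (yᵉ : R S rY ≡ toℕ y) where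
    private
      h = M S aHead (R S rY)

      y<n : R S rY < n
      y<n = subst (_< n) (sym yᵉ) (Fin.toℕ<n y)

      null : ¬ lastSlot y b < n → n ≡ lastSlot y b
      null nlt = ≤-antisym (≮⇒≥ nlt) (lastSlot-≤ y b (fit buf))

      head-lastSlot : lastSlot y b < n → h ≡ lastSlot y b
      head-lastSlot lt = trans (cong (M S aHead) yᵉ) (heads buf y lt)

    findLast-exec : Σ[ S′ ∈ Store 24 4 ] Exec findLast S 5 [] S′ × R S′ rP₀ ≡ lastSlot y b
    findLast-exec with h <? R S rK
    ... | no h≮k = _ , weaken (m≤n+m _ 2) ↭-refl (seq (assign (read y<n)) (ifFalse h≮k (assign copy))) ,
          trans nᵉ (null λ lt → h≮k (subst₂ _<_ (sym (head-lastSlot lt)) (sym (kᵉ buf))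
                                       (proj₁ (lastSlot-key y b (slots buf) lt))))
    ... | yes h<k with M S aKey h ≟ R S rY
    ...   | yes key = _ ,
            seq (assign (read y<n)) (ifTrue h<k (seq (assign (read h<n)) (ifTrue key skip))) ,
            head-lastSlot (key-lastSlot y b h (slots buf) h<b (trans key yᵉ) (fit buf))
      where
      h<b = subst (h <_) (kᵉ buf) h<k
      h<n = ≤-trans h<b (fit buf)
    ...   | no key = _ ,
            seq (assign (read y<n)) (ifTrue h<k (seq (assign (read h<n)) (ifFalse key (assign copy)))) ,
            trans nᵉ (null λ lt → key (trans (cong (M S aKey) (head-lastSlot lt))
                       (trans (proj₂ (lastSlot-key y b (slots buf) lt)) (sym yᵉ))))
      where
      h<n = ≤-trans (subst (h <_) (kᵉ buf) h<k) (fit buf)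

  -- The induction runs through the whole buffer, but entries with other ends cost nothing:
  -- `lastSlot` has already skipped them. So the time counts hits only.
  walk-exec : ∀ {S u y v} b → Slots (M S) b → length b ≤ n → R S rP ≡ lastSlot y b → R S rNN ≡ n →
    R S rV ≡ toℕ v → R S rU ≡ toℕ u → R S rY ≡ toℕ y →
    Σ[ S′ ∈ Store 24 4 ] Exec walk S (1 + 4 * length (earlier v (u , y) b)) (earlier v (u , y) b) S′
  walk-exec [] sl le pᵉ nᵉ vᵉ uᵉ yᵉ = _ , whileFalse λ lt → <-irrefl (trans pᵉ (sym nᵉ)) lt
  walk-exec {S} {u} {y} {v} ((x , y′) ∷ b) (item , key , next , sl) le pᵉ nᵉ vᵉ uᵉ yᵉ with y′ Fin.≟ y
  ... | no _ = walk-exec b sl (≤-trans (n≤1+n _) le) pᵉ nᵉ vᵉ uᵉ yᵉ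
  ... | yes refl
    with walk-exec {put rP (M S aNext (R S rP)) (put rX (M S aItem (R S rP)) S)} {u} {y} {v} b sl
           (≤-trans (n≤1+n _) le) (trans (cong (M S aNext) pᵉ) next) nᵉ vᵉ uᵉ yᵉ
  ...   | S′ , ex = S′ ,
          weaken (≤-reflexive (time _)) ↭-refl
            (whileTrue (subst₂ _<_ (sym pᵉ) (sym nᵉ) le)
              (seq (assign (read p<n)) (seq (emit v x y u vᵉ (trans (cong (M S aItem) pᵉ) item) yᵉ uᵉ)
                (assign (read p<n)))) ex)
    where
    p<n = subst (_< n) (sym pᵉ) le
    time : ∀ l → suc (3 + (1 + 4 * l)) ≡ 1 + 4 * suc l
    time = solve-∀

  stored : Pair {n} → List (Pair {n}) → List (Pair {n})
  stored a b = ifᵇ does (length b <? n) then a ∷ b else b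

  push-exec : ∀ {S u y b} → Buffer S b → R S rNN ≡ n → R S rU ≡ toℕ u → R S rY ≡ toℕ y →
    R S rP₀ ≡ lastSlot y b →
    Σ[ S′ ∈ Store 24 4 ] Exec push S 6 [] S′ × Buffer S′ (stored (u , y) b)
  push-exec {S} {u} {y} {b} buf nᵉ uᵉ yᵉ pᵉ with length b <? n
  ... | no k≮n rewrite dec-false (length b <? n) k≮n =
        _ , weaken (m≤n+m _ 4) ↭-refl (ifFalse (λ lt → k≮n (subst₂ _<_ (kᵉ buf) nᵉ lt)) skip) , buf
  ... | yes k<n rewrite dec-true (length b <? n) k<n =
        _ , ifTrue (subst₂ _<_ (sym (kᵉ buf)) (sym nᵉ) k<n)
              (seq (write k<n′) (seq (write k<n′) (seq (write k<n′) (seq (write y<n) (assign (add k+1<B)))))) ,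
        record { kᵉ = trans (+-comm _ 1) (cong suc (kᵉ buf)) ; fit = k<n
               ; slots = hit (kᵉ buf) uᵉ , hit (kᵉ buf) yᵉ , hit (kᵉ buf) pᵉ , Slots-cong b elsewhere (slots buf)
               ; heads = heads′ }
    where
    k<n′ = subst (_< n) (sym (kᵉ buf)) k<n
    y<n = subst (_< n) (sym yᵉ) (Fin.toℕ<n y)
    k+1<B : R S rK + 1 < B
    k+1<B = small (+-monoˡ-≤ 1 (≤-trans (<⇒≤ k<n′) (m≤n+m n _)))
    m′ : Fin 4 → ℕ → ℕ
    m′ = M (poke aHead (R S rY) (R S rK) (poke aKey (R S rK) (R S rY) (poke aItem (R S rK) (R S rU) (poke aNext (R S rK) (R S rP₀) S))))
    hit : ∀ {i k x z w : ℕ} → k ≡ i → x ≡ w → (ifᵇ does (i ≟ k) then x else z) ≡ w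
    hit {i} refl eq rewrite dec-true (i ≟ i) refl = eq
    miss : ∀ {i k x z : ℕ} → i ≢ k → (ifᵇ does (i ≟ k) then x else z) ≡ z
    miss {i} {k} i≢k rewrite dec-false (i ≟ k) i≢k = refl
    elsewhere : ∀ A i → A ≢ aHead → i < length b → m′ A i ≡ M S A i
    elsewhere A i A≢ lt = slot A A≢
      where
      i≢k : i ≢ R S rK
      i≢k eq = <-irrefl (trans eq (kᵉ buf)) lt
      slot : ∀ A → A ≢ aHead → m′ A i ≡ M S A i
      slot Fin.zero A≢ = contradiction refl A≢
      slot (Fin.suc Fin.zero) _ = miss i≢k
      slot (Fin.suc (Fin.suc Fin.zero)) _ = miss i≢k
      slot (Fin.suc (Fin.suc (Fin.suc Fin.zero))) _ = miss i≢k
    heads′ : Heads m′ ((u , y) ∷ b)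
    heads′ z lt with y Fin.≟ z
    ... | yes refl = hit yᵉ (kᵉ buf)
    ... | no y≢z   = trans (miss λ eq → y≢z (sym (Fin.toℕ-injective (trans eq yᵉ)))) (heads buf z lt)

  Buffer-frame : ∀ {p S t os S′ b} → Exec p S t os S′ → assigns rK p ≡ false →
    writes aHead p ≡ false → writes aKey p ≡ false → writes aItem p ≡ false → writes aNext p ≡ false →
    Buffer S b → Buffer S′ b
  Buffer-frame {p} {S} {S′ = S′} {b} ex k≡ h≡ y≡ i≡ x≡ buf = record
    { kᵉ = trans (frameR rK ex k≡) (kᵉ buf) ; fit = fit buf
    ; slots = Slots-cong b (λ A i _ _ → same A i) (slots buf)
    ; heads = λ y lt → trans (same aHead (toℕ y)) (heads buf y lt) }
    where
    same : ∀ A i → M S′ A i ≡ M S A i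
    same Fin.zero = frameM aHead ex h≡
    same (Fin.suc Fin.zero) = frameM aKey ex y≡
    same (Fin.suc (Fin.suc Fin.zero)) = frameM aItem ex i≡
    same (Fin.suc (Fin.suc (Fin.suc Fin.zero))) = frameM aNext ex x≡

  Buffer-cong : ∀ {S S′ b} → R S′ rK ≡ R S rK → M S′ ≡ M S → Buffer S b → Buffer S′ b
  Buffer-cong k≡ refl buf = record
    { kᵉ = trans k≡ (kᵉ buf) ; fit = fit buf ; slots = slots buf ; heads = heads buf }

  match-exec : ∀ {S u y v b} → Buffer S b → R S rNN ≡ n → R S rV ≡ toℕ v → R S rU ≡ toℕ u → R S rY ≡ toℕ y →
    Σ[ S′ ∈ Store 24 4 ] Exec match S (13 + 4 * length (earlier v (u , y) b)) (earlier v (u , y) b) S′ ×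
      Buffer S′ (stored (u , y) b)
  match-exec {S} {u} {y} {v} {b} buf nᵉ vᵉ uᵉ yᵉ =
    let S₁ , ex₁ , p₁ = findLast-exec {S} {b} {y} buf nᵉ yᵉ
        buf₁ = Buffer-frame ex₁ refl refl refl refl refl buf
        S₂ , ex₂ = walk-exec {put rP (R S₁ rP₀) S₁} {u} {y} {v} b (slots buf₁) (fit buf₁) p₁
                     (trans (frameR rNN ex₁ refl) nᵉ) (trans (frameR rV ex₁ refl) vᵉ)
                     (trans (frameR rU ex₁ refl) uᵉ) (trans (frameR rY ex₁ refl) yᵉ)
        S₃ , ex₃ , buf₃ = push-exec {S₂} {u} {y} {b}
                     (Buffer-frame ex₂ refl refl refl refl refl (Buffer-cong refl refl buf₁))
                     (trans (frameR rNN ex₂ refl) (trans (frameR rNN ex₁ refl) nᵉ))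
                     (trans (frameR rU ex₂ refl) (trans (frameR rU ex₁ refl) uᵉ))
                     (trans (frameR rY ex₂ refl) (trans (frameR rY ex₁ refl) yᵉ))
                     (trans (frameR rP₀ ex₂ refl) p₁)
    in S₃ , weaken (≤-reflexive (time (length (earlier v (u , y) b)))) (↭-reflexive (List.++-identityʳ _))
              (seq ex₁ (seq (assign copy) (seq ex₂ ex₃))) , buf₃
    where
    time : ∀ l → 5 + (1 + ((1 + 4 * l) + 6)) ≡ 13 + 4 * l
    time = solve-∀

  branchᵇ : ∀ {A : Set} {b : Bool} {x y : A} {P : Set} (P? : Dec P) → does P? ≡ b → (ifᵇ b then x else y) ≡ (ifᵇ does P? then x else y)
  branchᵇ P? eq = cong (λ b → ifᵇ b then _ else _) (sym eq)

  -- 9 covers `visitU` apart from the iterations of its inner loop; 22 is 21 for `visitY` and 1 for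
  -- the loop test. Emissions are counted separately.
  costU : Fin n → Fin n → ℕ
  costU v u = 9 + (ifᵇ does (u ≺? v) then 22 * deg u else 0)

  scanCost : Fin n → ℕ
  scanCost v = sum (map (suc ∘ costU v) (nbrs v))

  -- The nested loops of one pass

  module Pass (v : Fin n) (lo : ℕ) where

    record Constants (S : Store 24 4) : Set where
      field
        vᵉ  : R S rV ≡ toℕ v
        dvᵉ : R S rDv ≡ deg v
        nᵉ  : R S rNN ≡ n
        loᵉ : R S rLo ≡ lo

    open Constants

    Constants-cong : ∀ {S S′} → R S′ rV ≡ R S rV → R S′ rDv ≡ R S rDv → R S′ rNN ≡ R S rNN →
      R S′ rLo ≡ R S rLo → Constants S → Constants S′
    Constants-cong v≡ dv≡ n≡ lo≡ c = record
      { vᵉ = trans v≡ (vᵉ c) ; dvᵉ = trans dv≡ (dvᵉ c) ; nᵉ = trans n≡ (nᵉ c) ; loᵉ = trans lo≡ (loᵉ c) }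

    Constants-frame : ∀ {p S t os S′} → Exec p S t os S′ →
      assigns rV p ≡ false → assigns rDv p ≡ false → assigns rNN p ≡ false → assigns rLo p ≡ false →
      Constants S → Constants S′
    Constants-frame ex v≡ dv≡ n≡ lo≡ =
      Constants-cong (frameR rV ex v≡) (frameR rDv ex dv≡) (frameR rNN ex n≡) (frameR rLo ex lo≡)

    Scanned : Scan v lo → Store 24 4 → Set
    Scanned (i , b) S = R S rIdx ≡ i × Buffer S b

    Visited : Store 24 4 → List (Quad (Fin n)) → List (Pair {n}) → Set
    Visited S os b = Σ[ S′ ∈ Store 24 4 ]
      Exec visitPair S (15 + 4 * length os) os S′ × Scanned (suc (R S rIdx) , b) S′ × R S′ rIdx ≡ suc (R S rIdx)

    found-skip : ∀ {i} a b → i < lo → [] ≡ found v lo a (i , b) × b ≡ proj₂ (visit v lo a (i , b))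
    found-skip {i} a b i<lo rewrite dec-true (i <? lo) i<lo = refl , refl

    found-match : ∀ {i} a b → ¬ i < lo →
      earlier v a b ≡ found v lo a (i , b) × stored a b ≡ proj₂ (visit v lo a (i , b))
    found-match {i} a b i≮lo rewrite dec-false (i <? lo) i≮lo = refl , refl

    visitPair-exec : ∀ {S u y i b} → Constants S → Scanned (i , b) S → R S rU ≡ toℕ u → R S rY ≡ toℕ y →
      R S rIdx + 1 < B → Visited S (found v lo (u , y) (i , b)) (proj₂ (visit v lo (u , y) (i , b)))
    visitPair-exec {S} {u} {y} {_} {b} cs (refl , buf) uᵉ yᵉ fits′ = cases (R S rIdx <? lo)
      where
      time : ∀ l → suc (13 + 4 * l) + 1 ≡ 15 + 4 * l
      time = solve-∀
      cases : Dec (R S rIdx < lo) → Visited S (found v lo (u , y) (R S rIdx , b)) (proj₂ (visit v lo (u , y) (R S rIdx , b)))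
      cases (yes i<lo) = subst₂ (Visited S) (proj₁ (found-skip (u , y) b i<lo)) (proj₂ (found-skip (u , y) b i<lo))
        (_ , weaken (m≤n+m 3 12) ↭-refl
                (seq (ifTrue (subst (R S rIdx <_) (sym (loᵉ cs)) i<lo) skip) (assign (add fits′))) ,
          (+-comm _ 1 , Buffer-cong refl refl buf) , +-comm _ 1)
      cases (no i≮lo) = subst₂ (Visited S) (proj₁ (found-match (u , y) b i≮lo)) (proj₂ (found-match (u , y) b i≮lo))
        (let S′ , ex , buf′ = match-exec {S} {u} {y} {v} {b} buf (nᵉ cs) (vᵉ cs) uᵉ yᵉ
             idx≡ = frameR rIdx ex refl in
         _ , weaken (≤-reflexive (time (length (earlier v (u , y) b)))) (↭-reflexive (List.++-identityʳ _))
                (seq (ifFalse (λ lt → i≮lo (subst (R S rIdx <_) (loᵉ cs) lt)) ex)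
                     (assign (add (subst (λ z → z + 1 < B) (sym idx≡) fits′)))) ,
          (trans (+-comm _ 1) (cong suc idx≡) , Buffer-cong refl refl buf′) ,
          trans (+-comm _ 1) (cong suc idx≡))

    open TwoPaths v (_≺? v)

    record AtY (u : Fin n) (c : Scan v lo) (S : Store 24 4) : Set where
      field
        constants : Constants S
        scanned   : Scanned c S
        uᵉ        : R S rU ≡ toℕ u
        hᵉ        : R S rH ≡ start u + deg u
        -- At most `n` 2-paths for each array position before `rJ`, and one for each position from
        -- `start u` to `rG`, written without subtraction. This keeps `rIdx`, and later `rLo`,
        -- within a word.
        idx≤      : R S rIdx + start u ≤ n * R S rJ + R S rG
        g≤h       : R S rG ≤ R S rH
        j<        : R S rJ < length adj

    open AtY

    module LoopY (u : Fin n) = Loop (At adj) (AtY u)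
      (λ y → visits v lo (pathsVia u y)) (λ y → founds v lo (pathsVia u y)) (λ _ → 21) 4 rG rH visitY

    visitY-exec : ∀ u → LoopY.Iterates u
    visitY-exec u {y} {c} {S} inv (pos p pᵉ pl) g<h = cases (y ≺? v)
      where
      S₂ : Store 24 4
      S₂ = put rDy (deg y) (put rY (toℕ y) S)
      cs : Constants S₂
      cs = Constants-cong refl refl refl refl (constants inv)
      sc : Scanned c S₂
      sc = proj₁ (scanned inv) , Buffer-cong refl refl (proj₂ (scanned inv))
      idx<B : R S rIdx + 1 < B
      idx<B = small (+-mono-≤ (+-cancelʳ-≤ (start u) _ _ (begin
        R S rIdx + start u                      ≤⟨ idx≤ inv ⟩
        n * R S rJ + R S rG                     ≤⟨ +-mono-≤ (*-monoʳ-≤ n (<⇒≤ (j< inv))) (≤-trans (g≤h inv) (≤-reflexive (hᵉ inv))) ⟩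
        n * length adj + (start u + deg u)      ≤⟨ +-monoʳ-≤ (n * length adj) (+-monoʳ-≤ (start u) (deg≤n u)) ⟩
        n * length adj + (start u + n)          ≤⟨ m≤m+n _ (length adj) ⟩
        n * length adj + (start u + n) + length adj ≡⟨ rearrange (n * length adj) (start u) n (length adj) ⟩
        n * length adj + length adj + n + start u ∎)) ≤-refl)
        where
        open ≤-Reasoning hiding (start)
        rearrange : ∀ a s n l → a + (s + n) + l ≡ a + l + n + s
        rearrange = solve-∀
      g<B : R S rG + 1 < B
      g<B = small (+-monoˡ-≤ 1 (≤-trans (subst (_≤ length adj) pᵉ (<⇒≤ (Fin.toℕ<n p)))
              (≤-trans (m≤n+m _ (n * length adj)) (m≤m+n _ n))))

      Goal : List (Pair {n}) → Set
      Goal P = Σ[ S′ ∈ Store 24 4 ] Exec visitY S (21 + 4 * length (founds v lo P c)) (founds v lo P c) S′ ×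
        AtY u (visits v lo P c) S′ × R S′ rG ≡ suc (R S rG) × R S′ rH ≡ R S rH

      cases : Dec (y ≺ v) → Goal (pathsVia u y)
      cases (no ¬y≺v) = subst Goal (branchᵇ (y ≺? v) (dec-false (y ≺? v) ¬y≺v))
        (_ , weaken (m≤n+m 7 14) ↭-refl
               (seq (assign (readAdj (pos p pᵉ pl))) (seq (assign (readDeg y refl))
                 (seq (ifBelow-no {u = y} {v} refl refl (vᵉ cs) (dvᵉ cs) ¬y≺v) (assign (add g<B))))) ,
         record { constants = Constants-cong refl refl refl refl (constants inv)
                ; scanned = proj₁ sc , Buffer-cong refl refl (proj₂ sc)
                ; uᵉ = uᵉ inv ; hᵉ = hᵉ inv
                ; idx≤ = ≤-trans (idx≤ inv) (+-monoʳ-≤ (n * R S rJ) (m≤m+n _ 1))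
                ; g≤h = subst (_≤ R S rH) (+-comm 1 _) g<h
                ; j< = j< inv } ,
         +-comm _ 1 , refl)
      cases (yes y≺v) = subst Goal (branchᵇ (y ≺? v) (dec-true (y ≺? v) y≺v))
        (let S₃ , ex , sc₃ , idx₃ = visitPair-exec {S₂} {u} {y} {proj₁ c} {proj₂ c} cs sc (uᵉ inv) refl idx<B
             g≡ = frameR rG ex refl ; h≡ = frameR rH ex refl ; j≡ = frameR rJ ex refl in
         _ , weaken (≤-reflexive (trans (time (length (found v lo (u , y) c)))
                      (cong (λ l → 21 + 4 * l) (sym (cong length (List.++-identityʳ (found v lo (u , y) c)))))))
                    ↭-refl
               (seq (assign (readAdj (pos p pᵉ pl))) (seq (assign (readDeg y refl))
                 (seq (ifBelow-yes {u = y} {v} refl refl (vᵉ cs) (dvᵉ cs) y≺v ex)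
                      (assign (add (subst (λ z → z + 1 < B) (sym g≡) g<B)))))) ,
         record { constants = Constants-cong refl refl refl refl (Constants-frame ex refl refl refl refl cs)
                ; scanned = trans (proj₁ sc₃) (cong suc (proj₁ (scanned inv))) , Buffer-cong refl refl (proj₂ sc₃)
                ; uᵉ = trans (frameR rU ex refl) (uᵉ inv) ; hᵉ = trans h≡ (hᵉ inv)
                ; idx≤ = subst₂ _≤_ (sym (cong (_+ start u) idx₃))
                    (trans (sym (+-suc _ _)) (cong₂ (λ a b → n * a + b) (sym j≡) (trans (+-comm 1 _) (cong (_+ 1) (sym g≡)))))
                    (s≤s (idx≤ inv))
                ; g≤h = subst₂ _≤_ (trans (+-comm 1 _) (cong (_+ 1) (sym g≡))) (sym h≡) g<h
                ; j< = subst (_< length adj) (sym j≡) (j< inv) } ,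
         trans (+-comm _ 1) (cong suc g≡) , h≡)
        where
        time : ∀ l → 1 + (1 + ((3 + (15 + 4 * l)) + 1)) ≡ 21 + 4 * l
        time = solve-∀

    module _ {X : Set} (Pos : ℕ → X → Set) (Inv : Scan v lo → Store 24 4 → Set) (f : X → List (Pair {n}))
             (cost : X → ℕ) (K : ℕ) (j e : Fin 24) (body : Prog) where
      private
        module I = Loop Pos Inv (λ x → visits v lo (f x)) (λ x → founds v lo (f x)) cost K j e body

      steps-visits : ∀ xs c → I.steps xs c ≡ visits v lo (concatMap f xs) c
      steps-visits []       c = refl
      steps-visits (x ∷ xs) c = trans (steps-visits xs _) (sym (visits-++ v lo (f x) (concatMap f xs) c))

      outs-founds : ∀ xs c → I.outs xs c ≡ founds v lo (concatMap f xs) c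
      outs-founds []       c = refl
      outs-founds (x ∷ xs) c =
        trans (cong (founds v lo (f x) c ++_) (outs-founds xs _)) (sym (founds-++ v lo (f x) (concatMap f xs) c))

    record AtU (c : Scan v lo) (S : Store 24 4) : Set where
      field
        constants : Constants S
        scanned   : Scanned c S
        idx≤      : R S rIdx ≤ n * R S rJ
        j≤e       : R S rJ ≤ R S rE

    open AtU

    module LoopU = Loop (At adj) AtU
      (λ u → visits v lo (paths u)) (λ u → founds v lo (paths u)) (costU v) 4 rJ rE visitU

    sum-const : ∀ {X : Set} c (xs : List X) → sum (map (λ _ → c) xs) ≡ c * length xs
    sum-const c [] = sym (*-zeroʳ c)
    sum-const c (x ∷ xs) = trans (cong (c +_) (sum-const c xs)) (sym (*-suc c _))

    visitU-exec : LoopU.Iterates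
    visitU-exec {u} {c} {S} inv (pos p pᵉ pl) j<e = cases (u ≺? v)
      where
      S₂ : Store 24 4
      S₂ = put rDu (deg u) (put rU (toℕ u) S)
      S₄ : Store 24 4
      S₄ = put rH (start u + deg u) (put rG (start u) S₂)
      cs : Constants S₂
      cs = Constants-cong refl refl refl refl (constants inv)
      sc : Scanned c S₂
      sc = proj₁ (scanned inv) , Buffer-cong refl refl (proj₂ (scanned inv))
      j<adj : R S rJ < length adj
      j<adj = subst (_< length adj) pᵉ (Fin.toℕ<n p)
      j<B : R S rJ + 1 < B
      j<B = small (+-monoˡ-≤ 1 (≤-trans (<⇒≤ j<adj) (≤-trans (m≤n+m _ (n * length adj)) (m≤m+n _ n))))
      h<B : start u + deg u < B
      h<B = small (≤-trans (segment≤ u) (≤-trans (m≤n+m _ (n * length adj)) (≤-trans (m≤m+n _ n) (m≤m+n _ 1))))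
      atY : AtY u c S₄
      atY = record
        { constants = Constants-cong refl refl refl refl (constants inv)
        ; scanned = proj₁ sc , Buffer-cong refl refl (proj₂ sc)
        ; uᵉ = refl ; hᵉ = refl ; idx≤ = +-monoˡ-≤ (start u) (idx≤ inv) ; g≤h = m≤m+n _ _ ; j< = j<adj }

      Goal : List (Pair {n}) → ℕ → Set
      Goal P t = Σ[ S′ ∈ Store 24 4 ] Exec visitU S (9 + t + 4 * length (founds v lo P c)) (founds v lo P c) S′ ×
        AtU (visits v lo P c) S′ × R S′ rJ ≡ suc (R S rJ) × R S′ rE ≡ R S rE

      cases : Dec (u ≺ v) → Goal (paths u) (ifᵇ does (u ≺? v) then 22 * deg u else 0)
      cases (no ¬u≺v) = subst₂ Goal (branchᵇ (u ≺? v) (dec-false (u ≺? v) ¬u≺v)) (branchᵇ (u ≺? v) (dec-false (u ≺? v) ¬u≺v))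
        (_ , weaken (m≤n+m 7 2) ↭-refl
               (seq (assign (readAdj (pos p pᵉ pl))) (seq (assign (readDeg u refl))
                 (seq (ifBelow-no {u = u} {v} refl refl (vᵉ cs) (dvᵉ cs) ¬u≺v) (assign (add j<B))))) ,
         record { constants = Constants-cong refl refl refl refl (constants inv)
                ; scanned = proj₁ sc , Buffer-cong refl refl (proj₂ sc)
                ; idx≤ = ≤-trans (idx≤ inv) (*-monoʳ-≤ n (m≤m+n _ 1))
                ; j≤e = subst (_≤ R S rE) (+-comm 1 _) j<e } ,
         +-comm _ 1 , refl)
      cases (yes u≺v) = subst₂ Goal (branchᵇ (u ≺? v) (dec-true (u ≺? v) u≺v)) (branchᵇ (u ≺? v) (dec-true (u ≺? v) u≺v))
        (let P = concatMap (pathsVia u) (nbrs u)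
             S₅ , ex , atY′ = LoopY.loop u (visitY-exec u) (nbrs u) {c} {S₄} atY (segment u) refl
             os≡ = outs-founds (At adj) (AtY u) (pathsVia u) (λ _ → 21) 4 rG rH visitY (nbrs u) c
             ex′ = subst₂ (λ t os → Exec (while reg rG << reg rH run visitY) S₄ (1 + t + 4 * length os) os S₅)
                     (sum-const 22 (nbrs u)) os≡ ex
             j≡ = frameR rJ ex refl ; e≡ = frameR rE ex refl
             done = subst (λ c → AtY u c S₅) (steps-visits (At adj) (AtY u) (pathsVia u) (λ _ → 21) 4 rG rH visitY (nbrs u) c) atY′ in
         _ , weaken (≤-reflexive (time (22 * deg u) (length (founds v lo P c)))) (↭-reflexive (List.++-identityʳ _))
               (seq (assign (readAdj (pos p pᵉ pl))) (seq (assign (readDeg u refl))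
                 (seq (ifBelow-yes {u = u} {v} refl refl (vᵉ cs) (dvᵉ cs) u≺v
                         (seq (assign (readStart u refl)) (seq (assign (add h<B)) ex′)))
                      (assign (add (subst (λ z → z + 1 < B) (sym j≡) j<B)))))) ,
         record { constants = Constants-cong refl refl refl refl (AtY.constants done)
                ; scanned = proj₁ (AtY.scanned done) , Buffer-cong refl refl (proj₂ (AtY.scanned done))
                ; idx≤ = idx≤′ done
                ; j≤e = subst₂ _≤_ (trans (+-comm 1 _) (cong (_+ 1) (sym j≡))) (sym e≡) j<e } ,
         trans (+-comm _ 1) (cong suc j≡) , e≡)
        where
        time : ∀ d l → 1 + (1 + ((3 + (1 + (1 + (1 + d + 4 * l)))) + 1)) ≡ 9 + d + 4 * l
        time = solve-∀
        idx≤′ : ∀ {S c} → AtY u c S → R S rIdx ≤ n * (R S rJ + 1)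
        idx≤′ {S} done = +-cancelʳ-≤ (start u) _ _ (begin
          R S rIdx + start u                ≤⟨ AtY.idx≤ done ⟩
          n * R S rJ + R S rG               ≤⟨ +-monoʳ-≤ (n * R S rJ) (≤-trans (AtY.g≤h done) (≤-reflexive (AtY.hᵉ done))) ⟩
          n * R S rJ + (start u + deg u)    ≤⟨ +-monoʳ-≤ (n * R S rJ) (+-monoʳ-≤ (start u) (deg≤n u)) ⟩
          n * R S rJ + (start u + n)        ≡⟨ rearrange n (R S rJ) (start u) ⟩
          n * (R S rJ + 1) + start u        ∎)
          where
          open ≤-Reasoning hiding (start)
          rearrange : ∀ n j s → n * j + (s + n) ≡ n * (j + 1) + s
          rearrange = solve-∀

    pass-exec : ∀ {S} → Constants S → R S rA ≡ start v → R S rE ≡ start v + deg v → lo ≤ n * length adj →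
      Σ[ S′ ∈ Store 24 4 ] Exec pass S (5 + scanCost v + 4 * length (founds v lo (lowPaths v) (0 , []))) (founds v lo (lowPaths v) (0 , [])) S′ ×
        R S′ rIdx ≡ length (lowPaths v) × R S′ rLo ≡ lo + n × length (lowPaths v) ≤ n * length adj
    pass-exec {S} cs aᵉ eᵉ lo≤ =
      let S₄ , ex , at′ = LoopU.loop visitU-exec (nbrs v) {0 , []} {S₃} at₀ (subst (λ i → Seg (At adj) i (nbrs v)) (sym aᵉ) (segment v))
                            (trans eᵉ (cong (_+ deg v) (sym aᵉ)))
          os≡ = outs-founds (At adj) AtU paths (costU v) 4 rJ rE visitU (nbrs v) (0 , [])
          done = subst (λ c → AtU c S₄) (steps-visits (At adj) AtU paths (costU v) 4 rJ rE visitU (nbrs v) (0 , [])) at′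
          ex′ = subst (λ os → Exec (while reg rJ << reg rE run visitU) S₃ (1 + scanCost v + 4 * length os) os S₄) os≡ ex
          lo₄ = trans (frameR rLo ex refl) (loᵉ cs)
          n₄ = trans (frameR rNN ex refl) (nᵉ cs)
          e₄ = trans (frameR rE ex refl) eᵉ
          idx₄ = trans (proj₁ (scanned done)) (visits-count v lo (lowPaths v) 0 [])
      in _ , weaken (≤-reflexive (time (scanCost v) (length (founds v lo (lowPaths v) (0 , []))))) (↭-reflexive (List.++-identityʳ _))
               (seq (assign (const 0<B)) (seq (assign (const 0<B)) (seq (assign copy)
                 (seq ex′ (assign (add (subst₂ (λ a b → a + b < B) (sym lo₄) (sym n₄) lo+n<B))))))) ,
         idx₄ , cong₂ _+_ lo₄ n₄ ,
         subst (_≤ n * length adj) idx₄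
           (≤-trans (idx≤ done) (*-monoʳ-≤ n (≤-trans (j≤e done) (≤-trans (≤-reflexive e₄) (segment≤ v)))))
      where
      S₃ : Store 24 4
      S₃ = put rJ (R S rA) (put rK 0 (put rIdx 0 S))
      0<B : 0 < B
      0<B = <-trans z<s 1<B
      lo+n<B : lo + n < B
      lo+n<B = small (≤-trans (+-monoˡ-≤ n (≤-trans lo≤ (m≤m+n _ (length adj)))) (m≤m+n _ 1))
      at₀ : AtU (0 , []) S₃
      at₀ = record
        { constants = Constants-cong refl refl refl refl cs
        -- An empty buffer demands nothing of the arrays, every `lastSlot` being `n`; so setting
        -- `rK` to 0 clears it, whatever earlier passes left behind.
        ; scanned = refl , record { kᵉ = refl ; fit = z≤n ; slots = tt ; heads = λ y lt → contradiction lt (<-irrefl refl) }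
        ; idx≤ = z≤n
        ; j≤e = subst₂ _≤_ (sym aᵉ) (sym eᵉ) (m≤m+n _ _) }
      time : ∀ w l → 1 + (1 + (1 + ((1 + w + 4 * l) + 1))) ≡ 5 + w + 4 * l
      time = solve-∀

  -- `f` is fuel: each pass raises `lo` by `n`, which is positive. As the last pass starts below
  -- `length P`, it ends at most `n` beyond. Since `visitV-exec` runs the first pass separately and
  -- continues with `lo = n`, this becomes `q * n ≤ length P` for the further passes.
  passes-exec : ∀ f {v lo S} → let P = lowPaths v in
    length P ≤ lo + f → Pass.Constants v lo S → R S rA ≡ start v → R S rE ≡ start v + deg v →
    R S rIdx ≡ length P → length P ≤ n * length adj → 0 < n → lo ≤ length P + n →
    Σ[ q ∈ ℕ ] Σ[ S′ ∈ Store 24 4 ]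
      Exec passes S (1 + q * (6 + scanCost v) + 4 * length (pairs v (drop lo P))) (pairs v (drop lo P)) S′ ×
      lo + q * n ≤ length P + n
  passes-exec f {v} {lo} {S} fuel cs aᵉ eᵉ idxᵉ bound 0<n lo≤ = cases f fuel (lo <? length P)
    where
    P : List (Pair {n})
    P = lowPaths v
    Goal : Set
    Goal = Σ[ q ∈ ℕ ] Σ[ S′ ∈ Store 24 4 ]
      Exec passes S (1 + q * (6 + scanCost v) + 4 * length (pairs v (drop lo P))) (pairs v (drop lo P)) S′ ×
      lo + q * n ≤ length P + n
    time : ∀ w q l₁ l₂ → suc ((5 + w + 4 * l₁) + (1 + q * (6 + w) + 4 * l₂)) ≡ 1 + suc q * (6 + w) + 4 * (l₁ + l₂)
    time = solve-∀
    cases : ∀ f → length P ≤ lo + f → Dec (lo < length P) → Goal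
    cases f fuel (no lo≮) = 0 , S ,
      subst (λ Q → Exec passes S (1 + 4 * length (pairs v Q)) (pairs v Q) S) (sym (List.drop-all lo P (≮⇒≥ lo≮)))
        (whileFalse λ lt → lo≮ (subst₂ _<_ (Pass.Constants.loᵉ cs) idxᵉ lt)) ,
      subst (_≤ length P + n) (sym (+-identityʳ lo)) lo≤
    cases zero fuel (yes lo<) = contradiction (≤-trans lo< (≤-trans fuel (≤-reflexive (+-identityʳ lo)))) (<-irrefl refl)
    cases (suc f) fuel (yes lo<) =
      let S₁ , ex₁ , idx₁ , lo₁ , _ = Pass.pass-exec v lo {S} cs aᵉ eᵉ (≤-trans (<⇒≤ lo<) bound)
          cs₁ = record { vᵉ = trans (frameR rV ex₁ refl) (Pass.Constants.vᵉ cs)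
                       ; dvᵉ = trans (frameR rDv ex₁ refl) (Pass.Constants.dvᵉ cs)
                       ; nᵉ = trans (frameR rNN ex₁ refl) (Pass.Constants.nᵉ cs) ; loᵉ = lo₁ }
          q , S₂ , ex₂ , q≤ = passes-exec f {v} {lo + n} {S₁}
            (≤-trans fuel (≤-trans (≤-reflexive (+-suc lo f)) (≤-trans (+-monoˡ-≤ (lo + f) 0<n) (≤-reflexive (shuffle n lo f)))))
            cs₁ (trans (frameR rA ex₁ refl) aᵉ) (trans (frameR rE ex₁ refl) eᵉ) idx₁ bound 0<n (+-monoˡ-≤ n (<⇒≤ lo<))
          perm = total
      in suc q , S₂ ,
         weaken (≤-reflexive (trans (time (scanCost v) q (length (founds v lo P (0 , []))) (length (pairs v (drop (lo + n) P))))
                  (cong (λ l → 1 + suc q * (6 + scanCost v) + 4 * l)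
                    (trans (sym (List.length-++ (founds v lo P (0 , [])))) (↭-length perm))))) perm
           (whileTrue (subst₂ _<_ (sym (Pass.Constants.loᵉ cs)) (sym idxᵉ) lo<) ex₁ ex₂) ,
         subst (_≤ length P + n) (+-assoc lo n (q * n)) q≤
      where
      shuffle : ∀ n lo f → n + (lo + f) ≡ (lo + n) + f
      shuffle = solve-∀
      total : founds v lo P (0 , []) ++ pairs v (drop (lo + n) P) ↭ pairs v (drop lo P)
      total = ↭-trans (++⁺ʳ _ (founds-pass v lo P)) (↭-reflexive
        (trans (cong (λ Q → firstPairs v n (drop lo P) ++ pairs v Q) (sym (List.drop-drop lo n P)))
               (sym (pairs-split v n (drop lo P)))))

  visitV-exec : ∀ {v S} → let P = lowPaths v in
    R S rV ≡ toℕ v → R S rA ≡ start v → R S rDv ≡ deg v → R S rNN ≡ n →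
    Σ[ q ∈ ℕ ] Σ[ S′ ∈ Store 24 4 ]
      Exec visitV S (4 + suc q * (6 + scanCost v) + 4 * length (pairs v P)) (pairs v P) S′ × q * n ≤ length P
  visitV-exec {v} {S} vᵉ aᵉ dvᵉ nᵉ =
    let S₄ , ex₁ , idx₁ , lo₁ , bound = Pass.pass-exec v 0 {S₃} cs aᵉ (cong₂ _+_ aᵉ dvᵉ) z≤n
        cs₁ = record { vᵉ = trans (frameR rV ex₁ refl) vᵉ
                     ; dvᵉ = trans (frameR rDv ex₁ refl) dvᵉ
                     ; nᵉ = trans (frameR rNN ex₁ refl) nᵉ ; loᵉ = lo₁ }
        q , S₅ , ex₂ , q≤ = passes-exec (length P) {v} {n} {S₄} (m≤n+m _ n) cs₁
          (trans (frameR rA ex₁ refl) aᵉ) (trans (frameR rE ex₁ refl) (cong₂ _+_ aᵉ dvᵉ)) idx₁ bound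
          (≤-<-trans z≤n (Fin.toℕ<n v)) (m≤n+m n _)
    in q , S₅ ,
       weaken (≤-reflexive (trans (time (scanCost v) q (length (founds v 0 P (0 , []))) (length (pairs v (drop n P))))
                  (cong (λ l → 4 + suc q * (6 + scanCost v) + 4 * l)
                    (trans (sym (List.length-++ (founds v 0 P (0 , [])))) (↭-length total))))) total
         (seq (assign (add (subst₂ (λ a b → a + b < B) (sym aᵉ) (sym dvᵉ) e<B))) (seq (assign (const (<-trans z<s 1<B)))
           (seq (assign (const 1<B)) (whileTrue z<s ex₁ ex₂)))) ,
       +-cancelˡ-≤ n _ _ (≤-trans q≤ (≤-reflexive (+-comm _ n)))
    where
    P : List (Pair {n})
    P = lowPaths v
    S₃ : Store 24 4
    S₃ = put rIdx 1 (put rLo 0 (put rE (R S rA + R S rDv) S))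
    cs : Pass.Constants v 0 S₃
    cs = record { vᵉ = vᵉ ; dvᵉ = dvᵉ ; nᵉ = nᵉ ; loᵉ = refl }
    e<B : start v + deg v < B
    e<B = small (≤-trans (segment≤ v) (≤-trans (m≤n+m _ (n * length adj)) (≤-trans (m≤m+n _ n) (m≤m+n _ 1))))
    time : ∀ w q l₁ l₂ → 1 + (1 + (1 + suc ((5 + w + 4 * l₁) + (1 + q * (6 + w) + 4 * l₂)))) ≡ 4 + suc q * (6 + w) + 4 * (l₁ + l₂)
    time = solve-∀
    total : founds v 0 P (0 , []) ++ pairs v (drop n P) ↭ pairs v P
    total = ↭-trans (++⁺ʳ _ (founds-pass v 0 P)) (↭-reflexive (sym (pairs-split v n P)))

  -- The number of further passes is known only through `q * n ≤ length (lowPaths v)`. An abstract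
  -- `budget` keeps the amortised arithmetic out of the execution proof.
  module _ (budget : Fin n → ℕ)
           (enough : ∀ v q → q * n ≤ length (lowPaths v) →
              4 + suc q * (6 + scanCost v) + 4 * length (cycles v) ≤ budget v) where

    record AtI (_ : ⊤) (S : Store 24 4) : Set where
      field
        nᵉ   : R S rNN ≡ n
        lenᵉ : R S rLen ≡ length adj

    open AtI

    yield : Fin (length adj) → List (Quad (Fin n))
    yield p = ifᵇ does (Chosen? p) then cycles (lookup adj p) else []

    costI : Fin (length adj) → ℕ
    costI p = 11 + (ifᵇ does (Chosen? p) then budget (lookup adj p) else 0)

    module LoopI = Loop (λ i p → toℕ p ≡ i) AtI (λ _ _ → tt) (λ p _ → yield p) costI 0 rI rLen visitI

    visitI-exec : LoopI.Iterates
    visitI-exec {p} {_} {S} inv pᵉ _ = cases (Chosen? p)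
      where
      v w : Fin n
      v = lookup adj p
      w = ownerAt p
      S₇ : Store 24 4
      S₇ = put rC (start w + deg w) (put rC (deg w) (put rB (start w) (put rW (toℕ w)
             (put rDv (deg v) (put rA (start v) (put rV (toℕ v) S))))))
      i<B : R S rI + 1 < B
      i<B = small (+-monoˡ-≤ 1 (≤-trans (subst (_≤ length adj) pᵉ (<⇒≤ (Fin.toℕ<n p)))
              (≤-trans (m≤n+m _ (n * length adj)) (m≤m+n _ n))))
      c<B : start w + deg w < B
      c<B = small (≤-trans (segment≤ w) (≤-trans (m≤n+m _ (n * length adj)) (≤-trans (m≤m+n _ n) (m≤m+n _ 1))))

      Goal : List (Quad (Fin n)) → ℕ → Set
      Goal os t = Σ[ S′ ∈ Store 24 4 ] Exec visitI S (11 + t + 0 * length os) os S′ ×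
        AtI tt S′ × R S′ rI ≡ suc (R S rI) × R S′ rLen ≡ R S rLen

      finish : ∀ {t os S′} → Exec (if reg rI << reg rB then skip else (if reg rI << reg rC then visitV else skip)) S₇ (3 + t) os S′ → Goal os t
      finish {t} {os} ex =
        let i≡ = frameR rI ex refl ; n≡ = frameR rNN ex refl ; len≡ = frameR rLen ex refl in
        _ , weaken (≤-reflexive (time t)) (↭-reflexive (List.++-identityʳ os))
              (seq (assign (readAdj (pos p pᵉ refl))) (seq (assign (readStart v refl)) (seq (assign (readDeg v refl))
                (seq (assign (readAdj (proj₁ (ownerAt-Owner p)))) (seq (assign (readStart w refl)) (seq (assign (readDeg w refl))
                  (seq (assign (add c<B)) (seq ex (assign (add (subst (λ z → z + 1 < B) (sym i≡) i<B)))))))))))  ,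
        record { nᵉ = trans n≡ (nᵉ inv) ; lenᵉ = trans len≡ (lenᵉ inv) } ,
        trans (+-comm _ 1) (cong suc i≡) , len≡
        where
        time : ∀ t → 1 + (1 + (1 + (1 + (1 + (1 + (1 + ((3 + t) + 1))))))) ≡ 11 + t + 0
        time = solve-∀

      cases : Dec (Chosen p) → Goal (yield p) (ifᵇ does (Chosen? p) then budget v else 0)
      cases (yes (lo , hi)) = subst₂ Goal (branchᵇ (Chosen? p) (dec-true (Chosen? p) (lo , hi))) (branchᵇ (Chosen? p) (dec-true (Chosen? p) (lo , hi)))
        (let q , S′ , ex , q≤ = visitV-exec {v} {S₇} refl refl refl (nᵉ inv) in
         finish (weaken (≤-trans (s≤s (s≤s (enough v q q≤))) (n≤1+n _)) ↭-refl
           (ifFalse (λ lt → <-irrefl refl (≤-trans (subst (_< start w) (sym pᵉ) lt) lo))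
             (ifTrue (subst (_< start w + deg w) pᵉ hi) ex))))
      cases (no ¬c) = subst₂ Goal (branchᵇ (Chosen? p) (dec-false (Chosen? p) ¬c)) (branchᵇ (Chosen? p) (dec-false (Chosen? p) ¬c))
        (finish (skipped (R S rI <? start w)))
        where
        skipped : Dec (R S rI < start w) → Exec (if reg rI << reg rB then skip else (if reg rI << reg rC then visitV else skip)) S₇ 3 [] S₇
        skipped (yes lt) = weaken (n≤1+n 2) ↭-refl (ifTrue lt skip)
        skipped (no i≮)  = ifFalse i≮ (ifFalse (λ lt →
          ¬c (subst (start w ≤_) (sym pᵉ) (≮⇒≥ i≮) , subst (_< start w + deg w) (sym pᵉ) lt)) skip)

    sum-chosen : ∀ ps → sum (map (suc ∘ costI) ps) ≡
      12 * length ps + sum (map budget (map (lookup adj) (filter Chosen? ps)))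
    sum-chosen ps = trans (sum-filter Chosen? 12 (budget ∘ lookup adj) ps)
      (cong (λ xs → 12 * length ps + sum xs) (List.map-∘ (filter Chosen? ps)))

    outs-chosen : ∀ ps → LoopI.outs ps tt ≡ concatMap cycles (map (lookup adj) (filter Chosen? ps))
    outs-chosen ps = trans (outs-yield ps) (trans (concatMap-filter Chosen? (cycles ∘ lookup adj) ps)
                       (sym (List.concatMap-map cycles (lookup adj) (filter Chosen? ps))))
      where
      outs-yield : ∀ ps → LoopI.outs ps tt ≡ concatMap yield ps
      outs-yield []       = refl
      outs-yield (p ∷ ps) = cong (yield p ++_) (outs-yield ps)

    main-exec : ∀ S → Σ[ S′ ∈ Store 24 4 ]
      Exec main S (4 + 12 * length adj + sum (map budget chosen)) (concatMap cycles chosen) S′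
    main-exec S =
      let ps = allFin (length adj)
          S₃ = put rNN n (put rLen (length adj) (put rI 0 S))
          S′ , ex , _ = LoopI.loop visitI-exec ps {tt} {S₃} (record { nᵉ = refl ; lenᵉ = refl })
                          (Seg-tabulate (λ i → i) λ _ → refl)
                          (sym (List.length-tabulate {n = length adj} (λ i → i)))
      in S′ , weaken (≤-reflexive (trans (cong (λ s → 3 + (1 + s + 0)) (sum-chosen ps))
                (trans (cong (λ l → 3 + (1 + (12 * l + sum (map budget chosen)) + 0)) (List.length-tabulate {n = length adj} (λ i → i)))
                  (time (length adj) (sum (map budget chosen))))))
              (↭-reflexive (outs-chosen ps))
              (seq (assign (const (<-trans z<s 1<B))) (seq (assign sizeAdj) (seq (assign sizeV) ex)))
      where
      time : ∀ l s → 3 + (1 + (12 * l + s) + 0) ≡ 4 + 12 * l + s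
      time = solve-∀

-- 4-cycles up to rotation and reflection

-- The eight symmetries of the square in the order of `orbit`: `e0` to `e3` are shifts, `e4` to `e7`
-- a reversal followed by shifts. Group laws become tables.
pattern e0 = here refl
pattern e1 = there (here refl)
pattern e2 = there (there (here refl))
pattern e3 = there (there (there (here refl)))
pattern e4 = there (there (there (there (here refl))))
pattern e5 = there (there (there (there (there (here refl)))))
pattern e6 = there (there (there (there (there (there (here refl))))))
pattern e7 = there (there (there (there (there (there (there (here refl)))))))

module _ {A : Set} where

  ≈-refl : ∀ {q : Quad A} → q ≈ q
  ≈-refl = e0

  ≈-shift : ∀ {p q : Quad A} → p ≈ q → shift p ≈ q
  ≈-shift e0 = e1
  ≈-shift e1 = e2
  ≈-shift e2 = e3
  ≈-shift e3 = e0
  ≈-shift e4 = e5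
  ≈-shift e5 = e6
  ≈-shift e6 = e7
  ≈-shift e7 = e4

  ≈-reversal : ∀ {p q : Quad A} → p ≈ q → reversal p ≈ q
  ≈-reversal e0 = e4
  ≈-reversal e1 = e7
  ≈-reversal e2 = e6
  ≈-reversal e3 = e5
  ≈-reversal e4 = e0
  ≈-reversal e5 = e3
  ≈-reversal e6 = e2
  ≈-reversal e7 = e1

  ≈-sym : ∀ {p q : Quad A} → p ≈ q → q ≈ p
  ≈-sym e0 = e0
  ≈-sym e1 = e3
  ≈-sym e2 = e2
  ≈-sym e3 = e1
  ≈-sym e4 = e4
  ≈-sym e5 = e5
  ≈-sym e6 = e6
  ≈-sym e7 = e7

  ≈-trans : ∀ {p q r : Quad A} → p ≈ q → q ≈ r → p ≈ r
  ≈-trans e0 h = h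
  ≈-trans e1 h = ≈-shift h
  ≈-trans e2 h = ≈-shift (≈-shift h)
  ≈-trans e3 h = ≈-shift (≈-shift (≈-shift h))
  ≈-trans e4 h = ≈-reversal h
  ≈-trans e5 h = ≈-shift (≈-reversal h)
  ≈-trans e6 h = ≈-shift (≈-shift (≈-reversal h))
  ≈-trans e7 h = ≈-shift (≈-shift (≈-shift (≈-reversal h)))

∈-deduplicate : ∀ {n} {q : Quad (Fin n)} qs → q ∈ qs → Any (q ≈_) (deduplicate _≈?_ qs)
∈-deduplicate (q ∷ qs) (here refl) = here ≈-refl
∈-deduplicate {q} (r ∷ qs) (there q∈) with find (∈-deduplicate qs q∈)
... | s , s∈ , q≈s with r ≈? s
...   | yes r≈s = here (≈-trans q≈s (≈-sym r≈s))
...   | no r≉s  = there (lose (∈.∈-filter⁺ (¬? ∘ (r ≈?_)) s∈ r≉s) q≈s)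

module _ {n : ℕ} (G : Graph n) where

  C4-shift : ∀ {q} → IsC4 G q → IsC4 G (shift q)
  C4-shift ((xy ∷ xz ∷ xw ∷ []) ∷ (yz ∷ yw ∷ []) ∷ (zw ∷ []) ∷ [] ∷ [] , exy , eyz , ezw , ewx) =
    (yz ∷ yw ∷ ≢-sym xy ∷ []) ∷ (zw ∷ ≢-sym xz ∷ []) ∷ (≢-sym xw ∷ []) ∷ [] ∷ [] , eyz , ezw , ewx , exy

  C4-reversal : ∀ {q} → IsC4 G q → IsC4 G (reversal q)
  C4-reversal ((xy ∷ xz ∷ xw ∷ []) ∷ (yz ∷ yw ∷ []) ∷ (zw ∷ []) ∷ [] ∷ [] , exy , eyz , ezw , ewx) =
    (≢-sym zw ∷ ≢-sym yw ∷ ≢-sym xw ∷ []) ∷ (≢-sym yz ∷ ≢-sym xz ∷ []) ∷ (≢-sym xy ∷ []) ∷ [] ∷ [] ,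
    Graph.sym G ezw , Graph.sym G eyz , Graph.sym G exy , Graph.sym G ewx

  -- Each quad of `out` is equivalent to a survivor of the deduplication, and quads with a common
  -- survivor would be equivalent to each other.
  length≤#C4 : ∀ {out} → All (IsC4 G) out → AllPairs (λ p q → ¬ p ≈ q) out → length out ≤ #C4 G
  length≤#C4 {out} sound distinct = subst₂ _≤_ (sym (length-sum out)) (sym (length-sum (deduplicate _≈?_ (filter (isC4? G) (allQuads G)))))
    (sum-≤-reps _≈_ _ _ (AllPairs.map apart distinct)
      (All.map (λ {q} c → Any.map (λ q≈r → q≈r , ≤-refl) (∈-deduplicate _ (∈.∈-filter⁺ (isC4? G) (∈-all q) c))) sound))
    where
    apart : ∀ {p q : Quad (Fin n)} → ¬ p ≈ q → ∀ {r} → p ≈ r → ¬ q ≈ r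
    apart {p} {q} p≉q {r} p≈r q≈r = p≉q (≈-trans {p = p} {r} {q} p≈r (≈-sym {p = q} {r} q≈r))
    ∈-all : ∀ q → q ∈ allQuads G
    ∈-all (x , y , z , w) = ∈.∈-cartesianProduct⁺ (∈.∈-allFin x) (∈.∈-cartesianProduct⁺ (∈.∈-allFin y)
      (∈.∈-cartesianProduct⁺ (∈.∈-allFin z) (∈.∈-allFin w)))

module _ {n : ℕ} where

  -- The reflection in the diagonal through the first and third vertices, the one nontrivial
  -- symmetry that can carry an oriented quad to an oriented quad.
  flip₂₄ : Quad (Fin n) → Quad (Fin n)
  flip₂₄ (v , u , y , x) = v , x , y , u

  Apart : Quad (Fin n) → Quad (Fin n) → Set
  Apart p q = p ≢ q × p ≢ flip₂₄ q

  module _ (v : Fin n) where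

    ∈-later⁻ : ∀ {u y P q} → q ∈ later v (u , y) P → Σ[ x ∈ Fin n ] q ≡ (v , u , y , x) × (x , y) ∈ P
    ∈-later⁻ {u} {y} h with ∈.∈-map⁻ _ h
    ... | (x , _) , x∈ , eq with ∈.∈-filter⁻ (λ a → proj₂ a Fin.≟ y) x∈
    ...   | x∈P , refl = x , eq , x∈P

    ∈-later⁺ : ∀ {u y x P} → (x , y) ∈ P → (v , u , y , x) ∈ later v (u , y) P
    ∈-later⁺ {u} {y} x∈ = ∈.∈-map⁺ _ (∈.∈-filter⁺ (λ a → proj₂ a Fin.≟ y) x∈ refl)

    ∈-pairs⁻ : ∀ {P q} → Unique P → q ∈ pairs v P → Σ[ u ∈ Fin n ] Σ[ y ∈ Fin n ] Σ[ x ∈ Fin n ]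
      q ≡ (v , u , y , x) × (u , y) ∈ P × (x , y) ∈ P × u ≢ x
    ∈-pairs⁻ {(u , y) ∷ P} (a∉ ∷ uP) h with ∈.∈-++⁻ (later v (u , y) P) h
    ... | inj₁ h′ = let x , eq , x∈ = ∈-later⁻ {P = P} h′ in
          u , y , x , eq , here refl , there x∈ , λ u≡x → All.lookup a∉ x∈ (cong (_, y) u≡x)
    ... | inj₂ h′ = let u′ , y′ , x , eq , u∈ , x∈ , ne = ∈-pairs⁻ uP h′ in
          u′ , y′ , x , eq , there u∈ , there x∈ , ne

    ∈-pairs⁺ : ∀ {P u x y} → (u , y) ∈ P → (x , y) ∈ P → u ≢ x →
      (v , u , y , x) ∈ pairs v P ⊎ (v , x , y , u) ∈ pairs v P
    ∈-pairs⁺ (here refl) (here refl) ne = contradiction refl ne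
    ∈-pairs⁺ (here refl) (there x∈)  ne = inj₁ (∈.∈-++⁺ˡ (∈-later⁺ x∈))
    ∈-pairs⁺ (there u∈)  (here refl) ne = inj₂ (∈.∈-++⁺ˡ (∈-later⁺ u∈))
    ∈-pairs⁺ {a ∷ P} (there u∈) (there x∈) ne with ∈-pairs⁺ u∈ x∈ ne
    ... | inj₁ h = inj₁ (∈.∈-++⁺ʳ (later v a P) h)
    ... | inj₂ h = inj₂ (∈.∈-++⁺ʳ (later v a P) h)

    -- A quad from `later v (u , y) P` shows `(u , y)` in its second and third places. A quad from
    -- `pairs v P`, flipped or not, shows an entry of `P` there, and `(u , y)` does not recur in
    -- `P`.
    pairs-Apart : ∀ {P} → Unique P → AllPairs Apart (pairs v P)
    pairs-Apart [] = []
    pairs-Apart {(u , y) ∷ P} (a∉ ∷ uP) = AllPairs.++⁺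
      (AllPairs.map⁺ (AllPairs-map-All apart (All.tabulate (∈.∈-filter⁻ (λ a → proj₂ a Fin.≟ y)))
        (Unique.filter⁺ (λ a → proj₂ a Fin.≟ y) uP)))
      (pairs-Apart uP)
      (All.tabulate λ p∈ → All.tabulate λ q∈ →
        let x , p≡ , _ = ∈-later⁻ {P = P} p∈ ; u′ , y′ , x′ , q≡ , u′∈ , x′∈ , _ = ∈-pairs⁻ uP q∈ in
        subst₂ Apart (sym p≡) (sym q≡)
          ((λ e → All.lookup a∉ u′∈ (key e)) , λ e → All.lookup a∉ x′∈ (key e)))
      where
      key : ∀ {p q : Quad (Fin n)} → p ≡ q →
        (proj₁ (proj₂ p) , proj₁ (proj₂ (proj₂ p))) ≡ (proj₁ (proj₂ q) , proj₁ (proj₂ (proj₂ q)))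
      key = cong λ (_ , a , b , _) → a , b
      apart : ∀ {b c} → b ∈ P × proj₂ b ≡ y → c ∈ P × proj₂ c ≡ y → b ≢ c →
        Apart (v , u , y , proj₁ b) (v , u , y , proj₁ c)
      apart (_ , refl) (c∈ , refl) b≢c = (λ { refl → b≢c refl }) , λ { refl → All.lookup a∉ c∈ refl }

-- Oriented representatives of 4-cycles

module _ {n : ℕ} {G : Graph n} (L : AdjacencyLists G) where
  open AdjacencyLists L
  open DegreeOrder L

  rank-injective : ∀ {u v} → rank u ≡ rank v → u ≡ v
  rank-injective {u} {v} eq with <-cmp (deg u) (deg v)
  ... | tri< lt _ _ = contradiction (deg<⇒≺ {u} {v} lt) (<-irrefl eq)
  ... | tri> _ _ gt = contradiction (deg<⇒≺ {v} {u} gt) (<-irrefl (sym eq))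
  ... | tri≈ _ d≡ _ = Fin.toℕ-injective (+-cancelˡ-≡ (deg v * n) _ _ (subst (λ d → d * n + toℕ u ≡ rank v) d≡ eq))

  ≢⇒≺⊎≻ : ∀ {u v} → u ≢ v → u ≺ v ⊎ v ≺ u
  ≢⇒≺⊎≻ {u} {v} ne with <-cmp (rank u) (rank v)
  ... | tri< lt _ _ = inj₁ lt
  ... | tri≈ _ eq _ = contradiction (rank-injective eq) ne
  ... | tri> _ _ gt = inj₂ gt

  -- When D v y means y ≺ v, this is the enumeration. When it means v ≺ y, these
  -- are the 4-cycles to which the scans of the high paths are charged.
  module Orientation (D : Fin n → Fin n → Set) (D? : ∀ v y → Dec (D v y)) (asym : ∀ {v y} → D v y → ¬ D y v) where

    P : Fin n → List (Pair {n})
    P v = TwoPaths.twoPaths v (D? v)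

    P-fibres : ∀ v → P v ≡ fibres (λ u → filter (D? v) (nbrs u)) (filter (_≺? v) (nbrs v))
    P-fibres v = trans (concatMap-filter (_≺? v) _ (nbrs v)) (List.concatMap-cong inner (filter (_≺? v) (nbrs v)))
      where
      inner : ∀ u → concatMap (TwoPaths.pathsVia v (D? v) u) (nbrs u) ≡ map (u ,_) (filter (D? v) (nbrs u))
      inner u = trans (concatMap-filter (D? v) (λ y → (u , y) ∷ []) (nbrs u))
        (trans (sym (List.concatMap-map (λ z → z ∷ []) (u ,_) (filter (D? v) (nbrs u))))
               (List.concatMap-pure (map (u ,_) (filter (D? v) (nbrs u)))))

    P-Unique : ∀ v → Unique (P v)
    P-Unique v = subst Unique (sym (P-fibres v))
      (fibres-Unique _ (Unique.filter⁺ (_≺? v) (unique v)) λ u → Unique.filter⁺ (D? v) (unique u))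

    ∈-P⁻ : ∀ {v u y} → (u , y) ∈ P v → u ∈ nbrs v × u ≺ v × y ∈ nbrs u × D v y
    ∈-P⁻ {v} {u} {y} h with ∈-fibres⁻ _ {filter (_≺? v) (nbrs v)} (subst ((u , y) ∈_) (P-fibres v) h)
    ... | u∈ , y∈ = let u∈′ , u≺v = ∈.∈-filter⁻ (_≺? v) u∈ ; y∈′ , d = ∈.∈-filter⁻ (D? v) y∈ in u∈′ , u≺v , y∈′ , d

    ∈-P⁺ : ∀ {v u y} → u ∈ nbrs v → u ≺ v → y ∈ nbrs u → D v y → (u , y) ∈ P v
    ∈-P⁺ {v} {u} {y} u∈ u≺v y∈ d = subst ((u , y) ∈_) (sym (P-fibres v))
      (∈-fibres⁺ _ (∈.∈-filter⁺ (_≺? v) u∈ u≺v) (∈.∈-filter⁺ (D? v) y∈ d))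

    Oriented : Quad (Fin n) → Set
    Oriented (v , u , y , x) = u ≺ v × x ≺ v × D v y

    -- A symmetry that moves the first vertex to a neighbour contradicts the asymmetry of `_≺_`; one
    -- that exchanges it with the opposite vertex contradicts that of `D`. Only the identity and
    -- `flip₂₄` fix it.
    Oriented-≈ : ∀ {p q} → Oriented p → Oriented q → p ≈ q → p ≡ q ⊎ p ≡ flip₂₄ q
    Oriented-≈ _ _ e0 = inj₁ refl
    Oriented-≈ (a , b , c) (a′ , b′ , c′) e1 = contradiction b (<-asym a′)
    Oriented-≈ (a , b , c) (a′ , b′ , c′) e2 = contradiction c (asym c′)
    Oriented-≈ (a , b , c) (a′ , b′ , c′) e3 = contradiction a (<-asym b′)
    Oriented-≈ (a , b , c) (a′ , b′ , c′) e4 = contradiction b (<-asym b′)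
    Oriented-≈ (a , b , c) (a′ , b′ , c′) e5 = contradiction c (asym c′)
    Oriented-≈ (a , b , c) (a′ , b′ , c′) e6 = contradiction a (<-asym a′)
    Oriented-≈ _ _ e7 = inj₂ refl

    found-cycles : List (Fin n) → List (Quad (Fin n))
    found-cycles = concatMap λ v → pairs v (P v)

    ∈-found⁻ : ∀ {vs q} → q ∈ found-cycles vs → Oriented q × IsC4 G q
    ∈-found⁻ {vs} {q} q∈ with Any.satisfied (∈.∈-concatMap⁻ (λ v → pairs v (P v)) {xs = vs} q∈)
    ... | v , h with ∈-pairs⁻ v (P-Unique v) h
    ... | u , y , x , refl , u∈ , x∈ , u≢x with ∈-P⁻ u∈ | ∈-P⁻ x∈
    ... | uv , u≺v , yu , d | xv , x≺v , yx , _ =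
      (u≺v , x≺v , d) ,
      ((λ { refl → <-irrefl refl u≺v }) ∷ (λ { refl → asym d d }) ∷ (λ { refl → <-irrefl refl x≺v }) ∷ []) ∷
      ((λ { refl → Graph.irrefl G (edge yu) }) ∷ u≢x ∷ []) ∷
      ((λ { refl → Graph.irrefl G (edge yx) }) ∷ []) ∷ [] ∷ [] ,
      edge uv , edge yu , Graph.sym G (edge yx) , Graph.sym G (edge xv)
      where
      edge : ∀ {a b} → b ∈ nbrs a → Graph.Edge G a b
      edge {a} {b} = Equivalence.to (spec a b)

    found-IsC4 : ∀ vs → All (IsC4 G) (found-cycles vs)
    found-IsC4 vs = All.tabulate λ q∈ → proj₂ (∈-found⁻ {vs} q∈)

    found-distinct : ∀ {vs} → Unique vs → AllPairs (λ p q → ¬ p ≈ q) (found-cycles vs)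
    found-distinct {vs} uvs = AllPairs-map-All
      (λ {p} {q} op oq (p≢q , p≢) p≈q → [ p≢q , p≢ ] (Oriented-≈ {p} {q} op oq p≈q))
      (All.tabulate λ q∈ → proj₁ (∈-found⁻ {vs} q∈))
      (AllPairs.concat⁺ (All.map⁺ (All.tabulate λ {v} _ → pairs-Apart v (P-Unique v)))
        (AllPairs.map⁺ (AllPairs.map (λ {v} {w} v≢w → All.tabulate λ p∈ → All.tabulate λ q∈ → apart v≢w p∈ q∈) uvs)))
      where
      apart : ∀ {v w p q} → v ≢ w → p ∈ pairs v (P v) → q ∈ pairs w (P w) → Apart p q
      apart {v} {w} v≢w p∈ q∈ with ∈-pairs⁻ v (P-Unique v) p∈ | ∈-pairs⁻ w (P-Unique w) q∈
      ... | _ , _ , _ , refl , _ | _ , _ , _ , refl , _ = (λ e → v≢w (cong proj₁ e)) , λ e → v≢w (cong proj₁ e)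

    length-found : ∀ {vs} → Unique vs → length (found-cycles vs) ≤ #C4 G
    length-found {vs} uvs = length≤#C4 G (found-IsC4 vs) (found-distinct uvs)

    complete-oriented : ∀ {vs q} → IsC4 G q → Oriented q → proj₁ q ∈ vs → Any (q ≈_) (found-cycles vs)
    complete-oriented {vs} {v , u , y , x}
      ((vu ∷ vy ∷ vx ∷ []) ∷ (uy ∷ ux ∷ []) ∷ (yx ∷ []) ∷ [] ∷ [] , evu , euy , eyx , exv) (u≺v , x≺v , d) v∈
      with ∈-pairs⁺ v (∈-P⁺ (nbr evu) u≺v (nbr euy) d)
                      (∈-P⁺ (nbr (Graph.sym G exv)) x≺v (nbr (Graph.sym G eyx)) d) ux
      where
      nbr : ∀ {a b} → Graph.Edge G a b → b ∈ nbrs a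
      nbr {a} {b} = Equivalence.from (spec a b)
    ... | inj₁ h = lose (∈.∈-concatMap⁺ (λ v → pairs v (P v)) (Any.map (λ { refl → h }) v∈)) e0
    ... | inj₂ h = lose (∈.∈-concatMap⁺ (λ v → pairs v (P v)) (Any.map (λ { refl → h }) v∈)) e7

  module Low  = Orientation (λ v y → y ≺ v) (λ v y → y ≺? v) <-asym
  module High = Orientation _≺_ _≺?_ <-asym

  open Low using () renaming (Oriented to Top)

  C4-≢ : ∀ {v u y x} → IsC4 G (v , u , y , x) → v ≢ y × u ≢ x
  C4-≢ ((_ ∷ v≢y ∷ _ ∷ []) ∷ (_ ∷ u≢x ∷ []) ∷ _ , _) = v≢y , u≢x

  TopOf : Quad (Fin n) → Set
  TopOf q = Σ[ r ∈ Quad (Fin n) ] q ≈ r × IsC4 G r × Top r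

  topOf-cong : ∀ {p q} → p ≈ q → TopOf q → TopOf p
  topOf-cong {p} {q} p≈q (r , q≈r , top) = r , ≈-trans {p = p} {q} {r} p≈q q≈r , top

  -- The final of a knockout: `topOf` compares one pair of opposite vertices, `topOf₂` the other,
  -- and here the two winners meet. A shift brings the maximum to the front if necessary.
  topOf₃ : ∀ {v u y x} → IsC4 G (v , u , y , x) → y ≺ v → x ≺ u → u ≺ v ⊎ v ≺ u → TopOf (v , u , y , x)
  topOf₃ c y≺v x≺u (inj₁ u≺v) = _ , e0 , c , u≺v , <-trans x≺u u≺v , y≺v
  topOf₃ c y≺v x≺u (inj₂ v≺u) = _ , e3 , C4-shift G c , <-trans y≺v v≺u , v≺u , x≺u

  topOf₂ : ∀ {v u y x} → IsC4 G (v , u , y , x) → y ≺ v → u ≺ x ⊎ x ≺ u → TopOf (v , u , y , x)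
  topOf₂ c@((v≢u ∷ _) ∷ _ , _) y≺v (inj₂ x≺u) = topOf₃ c y≺v x≺u (≢⇒≺⊎≻ (≢-sym v≢u))
  topOf₂ {v} {u} {y} {x} c@((_ ∷ _ ∷ v≢x ∷ []) ∷ _ , _) y≺v (inj₁ u≺x) =
    topOf-cong {v , u , y , x} {v , x , y , u} e7
      (topOf₃ (C4-shift G (C4-shift G (C4-shift G (C4-reversal G c)))) y≺v u≺x (≢⇒≺⊎≻ (≢-sym v≢x)))

  topOf : ∀ {q} → IsC4 G q → TopOf q
  topOf {v , u , y , x} c with ≢⇒≺⊎≻ (proj₁ (C4-≢ c))
  ... | inj₂ y≺v = topOf₂ c y≺v (≢⇒≺⊎≻ (proj₂ (C4-≢ c)))
  ... | inj₁ v≺y = topOf-cong {v , u , y , x} {y , x , v , u} e2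
                     (topOf₂ (C4-shift G (C4-shift G c)) v≺y (≢⇒≺⊎≻ (≢-sym (proj₂ (C4-≢ c)))))

  enumerates : ∀ {vs} → Unique vs → (∀ {v w} → w ∈ nbrs v → v ∈ vs) → Enumerates G (Low.found-cycles vs)
  enumerates {vs} uvs covers = record
    { sound    = Low.found-IsC4 vs
    ; complete = complete
    ; distinct = Low.found-distinct uvs }
    where
    complete : ∀ q → IsC4 G q → Any (q ≈_) (Low.found-cycles vs)
    complete q c with topOf {q} c
    ... | r , q≈r , c′@(_ , edge , _) , top =
      Any.map (λ {s} r≈s → ≈-trans {p = q} {r} {s} q≈r r≈s)
        (Low.complete-oriented c′ top (covers (Equivalence.from (spec _ _) edge)))

-- The time bound

-- This is m δ̄; all counting is done with this natural number, and rationals enter only in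
-- `≤-timeBound`.
minDegreeSum : ∀ {n} → Graph n → ℕ
minDegreeSum G = sum (map (λ (u , v) → d G u ⊓ d G v) (edges G))

-- Identities are proved for unnormalised rationals, where equality is cross-multiplication and no
-- common divisors have to be cancelled.
toℚᵘ-fromℕ : ∀ k → ℚ.toℚᵘ (fromℕ k) ≃ mkℚᵘ (int k) 0
toℚᵘ-fromℕ k = ℚ.toℚᵘ-fromℚᵘ (mkℚᵘ (int k) 0)

fromℕ-+ : ∀ j k → fromℕ (j + k) ≡ fromℕ j ℚ.+ fromℕ k
fromℕ-+ j k = ℚ.toℚᵘ-injective (begin
  ℚ.toℚᵘ (fromℕ (j + k))                     ≈⟨ toℚᵘ-fromℕ (j + k) ⟩
  mkℚᵘ (int (j + k)) 0                         ≈⟨ *≡* (cong (ℤ._* int 1) (trans (ℤ.pos-+ j k)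
                                                  (sym (cong₂ ℤ._+_ (ℤ.*-identityʳ (int j)) (ℤ.*-identityʳ (int k)))))) ⟩
  mkℚᵘ (int j) 0 ℚᵘ.+ mkℚᵘ (int k) 0             ≈⟨ ℚᵘ.+-cong (toℚᵘ-fromℕ j) (toℚᵘ-fromℕ k) ⟨
  ℚ.toℚᵘ (fromℕ j) ℚᵘ.+ ℚ.toℚᵘ (fromℕ k)     ≈⟨ ℚ.toℚᵘ-homo-+ (fromℕ j) (fromℕ k) ⟨
  ℚ.toℚᵘ (fromℕ j ℚ.+ fromℕ k)               ∎)
  where open ℚᵘ.≃-Reasoning

fromℕ-* : ∀ j k → fromℕ (j * k) ≡ fromℕ j ℚ.* fromℕ k
fromℕ-* j k = ℚ.toℚᵘ-injective (begin
  ℚ.toℚᵘ (fromℕ (j * k))                     ≈⟨ toℚᵘ-fromℕ (j * k) ⟩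
  mkℚᵘ (int (j * k)) 0                         ≈⟨ *≡* (cong (ℤ._* int 1) (ℤ.pos-* j k)) ⟩
  mkℚᵘ (int j) 0 ℚᵘ.* mkℚᵘ (int k) 0             ≈⟨ ℚᵘ.*-cong (toℚᵘ-fromℕ j) (toℚᵘ-fromℕ k) ⟨
  ℚ.toℚᵘ (fromℕ j) ℚᵘ.* ℚ.toℚᵘ (fromℕ k)     ≈⟨ ℚ.toℚᵘ-homo-* (fromℕ j) (fromℕ k) ⟨
  ℚ.toℚᵘ (fromℕ j ℚ.* fromℕ k)               ∎)
  where open ℚᵘ.≃-Reasoning

fromℕ-mono-≤ : ∀ {j k} → j ≤ k → fromℕ j ℚ.≤ fromℕ k
fromℕ-mono-≤ {j} {k} j≤k = ℚ.toℚᵘ-cancel-≤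
  (ℚᵘ.≤-respˡ-≃ (ℚᵘ.≃-sym (toℚᵘ-fromℕ j)) (ℚᵘ.≤-respʳ-≃ (ℚᵘ.≃-sym (toℚᵘ-fromℕ k))
    (*≤* (ℤ.*-monoʳ-≤-nonNeg (int 1) (ℤ.+≤+ j≤k)))))

*-÷ : ∀ m k → fromℕ (suc m) ℚ.* (k ÷ suc m) ≡ fromℕ k
*-÷ m k = ℚ.toℚᵘ-injective (begin
  ℚ.toℚᵘ (fromℕ (suc m) ℚ.* (k ÷ suc m))             ≈⟨ ℚ.toℚᵘ-homo-* (fromℕ (suc m)) (k ÷ suc m) ⟩
  ℚ.toℚᵘ (fromℕ (suc m)) ℚᵘ.* ℚ.toℚᵘ (k ÷ suc m)     ≈⟨ ℚᵘ.*-cong (toℚᵘ-fromℕ (suc m))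
                                                          (ℚ.toℚᵘ-fromℚᵘ (mkℚᵘ (int k) m)) ⟩
  mkℚᵘ (int (suc m)) 0 ℚᵘ.* mkℚᵘ (int k) m                 ≈⟨ *≡* (trans (ℤ.*-identityʳ _) (trans (ℤ.*-comm (int (suc m)) (int k))
                                                          (cong (λ z → int k ℤ.* int (suc z)) (sym (+-identityʳ m))))) ⟩
  mkℚᵘ (int k) 0                                       ≈⟨ toℚᵘ-fromℕ k ⟨
  ℚ.toℚᵘ (fromℕ k)                                   ∎)
  where open ℚᵘ.≃-Reasoning

-- Without edges the factor 0 makes the junk quotient harmless; otherwise the denominator cancels.
numEdges*avgDegeneracy : ∀ {n} (G : Graph n) → fromℕ (numEdges G) ℚ.* avgDegeneracy G ≡ fromℕ (minDegreeSum G)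
numEdges*avgDegeneracy G with edges G
... | []     = refl
... | es@(_ ∷ es′) = *-÷ (length es′) (sum (map (λ (u , v) → d G u ⊓ d G v) es))

≤-timeBound : ∀ {n} (G : Graph n) c {t} → t ≤ c * (1 + (minDegreeSum G + #C4 G)) → fromℕ t ℚ.≤ timeBound c G
≤-timeBound G c {t} t≤ = ℚ.≤-trans (fromℕ-mono-≤ t≤) (ℚ.≤-reflexive (begin
  fromℕ (c * (1 + (minDegreeSum G + #C4 G)))
    ≡⟨ fromℕ-* c (1 + (minDegreeSum G + #C4 G)) ⟩
  fromℕ c ℚ.* fromℕ (1 + (minDegreeSum G + #C4 G))
    ≡⟨ cong (fromℕ c ℚ.*_) (trans (fromℕ-+ 1 (minDegreeSum G + #C4 G)) (cong (ℚ.1ℚ ℚ.+_) (fromℕ-+ (minDegreeSum G) (#C4 G)))) ⟩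
  fromℕ c ℚ.* (ℚ.1ℚ ℚ.+ (fromℕ (minDegreeSum G) ℚ.+ fromℕ (#C4 G)))
    ≡⟨ cong (λ z → fromℕ c ℚ.* (ℚ.1ℚ ℚ.+ (z ℚ.+ fromℕ (#C4 G)))) (numEdges*avgDegeneracy G) ⟨
  timeBound c G ∎))
  where open ≡-Reasoning

-- Charging the passes to 2-paths and 4-cycles

module Budget {n : ℕ} {G : Graph n} (L : AdjacencyLists G) where
  open AdjacencyLists L
  open DegreeOrder L
  open Adjacency L

  below : Fin n → List (Fin n)
  below v = filter (_≺? v) (nbrs v)

  fan : Fin n → ℕ
  fan v = sum (map deg (below v))

  private
    length-paths : ∀ (D : Fin n → Fin n → Set) (D? : ∀ v y → Dec (D v y)) (asym : ∀ {v y} → D v y → ¬ D y v) v →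
      length (Orientation.P L D D? asym v) ≡ sum (map (λ u → length (filter (D? v) (nbrs u))) (below v))
    length-paths D D? asym v = trans (cong length (Orientation.P-fibres L D D? asym v))
      (trans (length-concatMap _ (below v))
        (cong sum (List.map-cong (λ u → List.length-map (u ,_) (filter (D? v) (nbrs u))) (below v))))

    length-lowPaths : ∀ v → length (lowPaths v) ≡ sum (map (λ u → length (filter (_≺? v) (nbrs u))) (below v))
    length-lowPaths = length-paths (λ v y → y ≺ v) (λ v y → y ≺? v) <-asym

    length-highPaths : ∀ v → length (highPaths v) ≡ sum (map (λ u → length (filter (v ≺?_) (nbrs u))) (below v))
    length-highPaths = length-paths _≺_ _≺?_ <-asym

    length-both : ∀ v → length (lowPaths v) + length (highPaths v) ≡
      sum (map (λ u → length (filter (_≺? v) (nbrs u)) + length (filter (v ≺?_) (nbrs u))) (below v))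
    length-both v = trans (cong₂ _+_ (length-lowPaths v) (length-highPaths v)) (sym (sum-map-+ _ _ (below v)))

  paths≤fan : ∀ v → length (lowPaths v) + length (highPaths v) ≤ fan v
  paths≤fan v = ≤-trans (≤-reflexive (length-both v))
    (sum-map-mono (below v) λ {u} _ → length-filter₂ (_≺? v) (v ≺?_) (v Fin.≟_) <-asym (nbrs u))

  -- What is neither a low nor a high path is a return v - u - v, and each `u` has at most one.
  fan≤paths : ∀ v → fan v ≤ length (lowPaths v) + length (highPaths v) + deg v
  fan≤paths v = begin
    fan v
      ≤⟨ sum-map-mono (below v) (λ {u} _ →
           ≤-trans (length-filter₃ (_≺? v) (v ≺?_) (v Fin.≟_) trichotomy (nbrs u)) (+-monoʳ-≤ _ (once u))) ⟩
    sum (map (λ u → length (filter (_≺? v) (nbrs u)) + length (filter (v ≺?_) (nbrs u)) + 1) (below v))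
      ≡⟨ sum-map-+ _ (λ _ → 1) (below v) ⟩
    sum (map (λ u → length (filter (_≺? v) (nbrs u)) + length (filter (v ≺?_) (nbrs u))) (below v)) + sum (map (λ _ → 1) (below v))
      ≡⟨ cong₂ _+_ (length-both v) (length-sum (below v)) ⟨
    length (lowPaths v) + length (highPaths v) + length (below v)
      ≤⟨ +-monoʳ-≤ _ (List.length-filter (_≺? v) (nbrs v)) ⟩
    length (lowPaths v) + length (highPaths v) + deg v ∎
    where
    open ≤-Reasoning hiding (start)
    trichotomy : ∀ y → y ≺ v ⊎ v ≺ y ⊎ v ≡ y
    trichotomy y with v Fin.≟ y
    ... | yes eq = inj₂ (inj₂ eq)
    ... | no ne with ≢⇒≺⊎≻ L ne
    ...   | inj₁ v≺y = inj₂ (inj₁ v≺y)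
    ...   | inj₂ y≺v = inj₁ y≺v
    once : ∀ u → length (filter (v Fin.≟_) (nbrs u)) ≤ 1
    once u = length-≤-⊆ {ys = v ∷ []} (Unique.filter⁺ (v Fin.≟_) (unique u))
      λ x∈ → here (sym (proj₂ (∈.∈-filter⁻ (v Fin.≟_) {xs = nbrs u} x∈)))

  budget : Fin n → ℕ
  budget v = 10 + 10 * deg v + 93 * fan v + 70 * length (cycles v) + 22 * length (pairs v (highPaths v))

  -- For a vertex of degree D there are q + 1 passes, T low paths in p pairs, and
  -- U high paths in r pairs. The last two hypotheses are pairs-bound.
  budget-arith : ∀ {n q D F T U p r w} → 0 < n → q * n ≤ T → D ≤ n → T + U ≤ F → F ≤ T + U + D → w ≡ 10 * D + 22 * F →
    2 * q * T ≤ 2 * p + T + n * (q * q) → 2 * q * U ≤ 2 * r + U + n * (q * q) →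
    4 + suc q * (6 + w) + 4 * p ≤ 10 + 10 * D + 93 * F + 70 * p + 22 * r
  budget-arith {n} {q} {D} {F} {T} {U} {p} {r} 0<n qn≤T D≤n T+U≤F F≤ refl low high = begin
    4 + suc q * (6 + (10 * D + 22 * F)) + 4 * p
      -- Only in the `q` further passes is `F` split into low paths, high paths and returns; the
      -- first pass is paid by `F` itself.
      ≤⟨ +-monoˡ-≤ (4 * p) (+-monoʳ-≤ 4 (+-monoʳ-≤ (6 + (10 * D + 22 * F))
           (*-monoʳ-≤ q (+-monoʳ-≤ 6 (+-monoʳ-≤ (10 * D) (*-monoʳ-≤ 22 F≤)))))) ⟩
    4 + (6 + (10 * D + 22 * F) + q * (6 + (10 * D + 22 * (T + U + D)))) + 4 * p
      ≡⟨ expand q D F T U p ⟩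
    10 + 10 * D + 22 * F + 4 * p + (6 * q + 32 * (q * D) + 22 * (q * T) + 11 * (2 * q * U))
      ≤⟨ +-monoʳ-≤ (10 + 10 * D + 22 * F + 4 * p)
           (+-mono-≤ (+-mono-≤ (+-mono-≤ (*-monoʳ-≤ 6 q≤T) (*-monoʳ-≤ 32 qD≤T)) (*-monoʳ-≤ 22 qT≤)) (*-monoʳ-≤ 11 qU≤)) ⟩
    10 + 10 * D + 22 * F + 4 * p + (6 * T + 32 * T + 22 * (2 * p + T) + 11 * (2 * r + U + (2 * p + T)))
      ≡⟨ collect D F T U p r ⟩
    10 + 10 * D + 22 * F + (71 * T + 11 * U) + 70 * p + 22 * r
      ≤⟨ +-monoˡ-≤ (22 * r) (+-monoˡ-≤ (70 * p) (+-monoʳ-≤ (10 + 10 * D + 22 * F)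
           (≤-trans (+-monoʳ-≤ (71 * T) (*-monoˡ-≤ U (m≤m+n 11 60)))
             (≤-trans (≤-reflexive (sym (*-distribˡ-+ 71 T U))) (*-monoʳ-≤ 71 T+U≤F))))) ⟩
    10 + 10 * D + 22 * F + 71 * F + 70 * p + 22 * r
      ≡⟨ final D F p r ⟩
    10 + 10 * D + 93 * F + 70 * p + 22 * r ∎
    where
    open ≤-Reasoning hiding (start)
    expand : ∀ q D F T U p → 4 + (6 + (10 * D + 22 * F) + q * (6 + (10 * D + 22 * (T + U + D)))) + 4 * p ≡
      10 + 10 * D + 22 * F + 4 * p + (6 * q + 32 * (q * D) + 22 * (q * T) + 11 * (2 * q * U))
    expand = solve-∀
    collect : ∀ D F T U p r → 10 + 10 * D + 22 * F + 4 * p + (6 * T + 32 * T + 22 * (2 * p + T) + 11 * (2 * r + U + (2 * p + T))) ≡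
      10 + 10 * D + 22 * F + (71 * T + 11 * U) + 70 * p + 22 * r
    collect = solve-∀
    final : ∀ D F p r → 10 + 10 * D + 22 * F + 71 * F + 70 * p + 22 * r ≡ 10 + 10 * D + 93 * F + 70 * p + 22 * r
    final = solve-∀
    q≤T : q ≤ T
    q≤T = ≤-trans (≤-trans (≤-reflexive (sym (*-identityʳ q))) (*-monoʳ-≤ q 0<n)) qn≤T
    qD≤T : q * D ≤ T
    qD≤T = ≤-trans (*-monoʳ-≤ q D≤n) qn≤T
    nqq≤qT : n * (q * q) ≤ q * T
    nqq≤qT = ≤-trans (≤-reflexive (shuffle n q)) (*-monoʳ-≤ q qn≤T)
      where
      shuffle : ∀ n q → n * (q * q) ≡ q * (q * n)
      shuffle = solve-∀
    -- As `q * n ≤ T`, the term `n * (q * q)` is at most `q * T`, half of the left side of `low`,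
    -- and cancels against it.
    qT≤ : q * T ≤ 2 * p + T
    qT≤ = +-cancelʳ-≤ (q * T) _ _ (≤-trans (≤-reflexive (double q T)) (≤-trans low (+-monoʳ-≤ (2 * p + T) nqq≤qT)))
      where
      double : ∀ q T → q * T + q * T ≡ 2 * q * T
      double = solve-∀
    -- Nothing relates `q * n` to `U`, so the same term in `high` is again bounded by `q * T`, and
    -- thus charged to the low pairs.
    qU≤ : 2 * q * U ≤ 2 * r + U + (2 * p + T)
    qU≤ = ≤-trans high (+-monoʳ-≤ (2 * r + U) (≤-trans nqq≤qT qT≤))

  budget-enough : ∀ v q → q * n ≤ length (lowPaths v) →
    4 + suc q * (6 + sum (map (λ u → 10 + (ifᵇ does (u ≺? v) then 22 * deg u else 0)) (nbrs v))) + 4 * length (cycles v) ≤ budget v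
  budget-enough v q qn≤ = budget-arith {n} {q} {deg v} {fan v} {length (lowPaths v)} {length (highPaths v)}
    {length (cycles v)} {length (pairs v (highPaths v))} (≤-<-trans z≤n (Fin.toℕ<n v)) qn≤ (deg≤n v) (paths≤fan v) (fan≤paths v)
    (trans (sum-filter (_≺? v) 10 (λ u → 22 * deg u) (nbrs v)) (cong (10 * deg v +_) (sum-map-* 22 deg (below v))))
    (pairs-bound v q (lowPaths v)) (pairs-bound v q (highPaths v))

  -- Sums over arcs compared with m δ̄

  private
    arcs : List (Fin n × Fin n)
    arcs = fibres nbrs (allFin n)

    minDeg : Fin n × Fin n → ℕ
    minDeg (u , v) = d G u ⊓ d G v

    deg≤d : ∀ v → deg v ≤ d G v
    deg≤d v = length-≤-⊆ (unique v) λ {u} u∈ →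
      ∈.∈-filter⁺ (Graph.edge? G v) (∈.∈-allFin u) (Equivalence.to (spec v u) u∈)

    ∈-edges : ∀ {u v} → toℕ u < toℕ v → Graph.Edge G u v → (u , v) ∈ edges G
    ∈-edges {u} {v} u<v e = ∈.∈-filter⁺ (λ (u , v) → (u Fin.<? v) ×-dec Graph.edge? G u v)
      (∈.∈-cartesianProduct⁺ (∈.∈-allFin u) (∈.∈-allFin v)) (u<v , e)

    arc-edge : ∀ {u v} → (v , u) ∈ arcs → (v , u) ∈ edges G ++ map swap (edges G)
    arc-edge {u} {v} h with <-cmp (toℕ v) (toℕ u) | Equivalence.to (spec v u) (proj₂ (∈-fibres⁻ nbrs {allFin n} h))
    ... | tri< v<u _ _ | e = ∈.∈-++⁺ˡ (∈-edges v<u e)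
    ... | tri> _ _ u<v | e = ∈.∈-++⁺ʳ (edges G) (∈.∈-map⁺ swap (∈-edges u<v (Graph.sym G e)))
    ... | tri≈ _ eq _  | e with Fin.toℕ-injective eq
    ...   | refl = contradiction e (Graph.irrefl G)

  -- The arcs are the edges taken in both directions, and the minimum of the two degrees does not
  -- depend on the direction.
  sum-arcs : sum (map (λ v → sum (map (λ u → deg v ⊓ deg u) (nbrs v))) (allFin n)) ≤ 2 * minDegreeSum G
  sum-arcs = begin
    sum (map (λ v → sum (map (λ u → deg v ⊓ deg u) (nbrs v))) (allFin n))
      ≡⟨ cong sum (List.map-cong (λ v → cong sum (List.map-∘ (nbrs v))) (allFin n)) ⟩
    sum (map (λ v → sum (map f (map (v ,_) (nbrs v)))) (allFin n))
      ≡⟨ sum-concatMap f (λ v → map (v ,_) (nbrs v)) (allFin n) ⟨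
    sum (map f arcs)
      ≤⟨ sum-≤-⊆ f minDeg (fibres-Unique nbrs (Unique.allFin⁺ n) unique) (λ { {v , u} h → arc-edge h , ⊓-mono-≤ (deg≤d v) (deg≤d u) }) ⟩
    sum (map minDeg (edges G ++ map swap (edges G)))
      ≡⟨ trans (cong sum (List.map-++ minDeg (edges G) _)) (sum-++ (map minDeg (edges G)) _) ⟩
    minDegreeSum G + sum (map minDeg (map swap (edges G)))
      ≡⟨ cong (minDegreeSum G +_) (trans (cong sum (trans (sym (List.map-∘ (edges G)))
           (List.map-cong (λ (u , v) → ⊓-comm (d G v) (d G u)) (edges G))))
           (sym (+-identityʳ (minDegreeSum G)))) ⟩
    2 * minDegreeSum G ∎
    where
    open ≤-Reasoning hiding (start)
    f : Fin n × Fin n → ℕ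
    f (v , u) = deg v ⊓ deg u

  private
    nonempty : ∀ {u v} → u ∈ nbrs v → 1 ≤ deg v
    nonempty {v = v} u∈ with nbrs v
    ... | _ ∷ _ = s≤s z≤n

  -- Both ends of an arc have degree at least 1, so every arc contributes at least 1 to the sum in
  -- `sum-arcs`.
  length-adj≤minDegreeSum : length adj ≤ 2 * minDegreeSum G
  length-adj≤minDegreeSum = begin
    length adj                ≡⟨ length-adj ⟩
    sum (map deg (allFin n))  ≤⟨ sum-map-mono (allFin n) (λ {v} _ → ≤-trans (≤-reflexive (length-sum (nbrs v)))
                                   (sum-map-mono (nbrs v) λ u∈ → ⊓-glb (nonempty u∈) (nonempty (nbr-sym u∈)))) ⟩
    sum (map (λ v → sum (map (λ u → deg v ⊓ deg u) (nbrs v))) (allFin n)) ≤⟨ sum-arcs ⟩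
    2 * minDegreeSum G        ∎
    where open ≤-Reasoning hiding (start)

  sum-fan : sum (map fan (allFin n)) ≤ 2 * minDegreeSum G
  sum-fan = ≤-trans (sum-map-mono (allFin n) λ {v} _ → sum-filter-≤ (_≺? v) (nbrs v) λ {u} u≺v →
    ⊓-glb (≺⇒deg≤ {u} {v} u≺v) ≤-refl) sum-arcs

  sum-chosen-≤ : ∀ f → sum (map f chosen) ≤ sum (map f (allFin n))
  sum-chosen-≤ f = sum-≤-⊆ f f chosen-Unique λ {v} _ → ∈.∈-allFin v , ≤-refl

  length-chosen : length chosen ≤ length adj
  length-chosen = begin
    length chosen                                    ≡⟨ List.length-map _ (filter Chosen? (allFin (length adj))) ⟩
    length (filter Chosen? (allFin (length adj)))    ≤⟨ List.length-filter Chosen? (allFin (length adj)) ⟩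
    length (allFin (length adj))                     ≡⟨ List.length-tabulate {n = length adj} _ ⟩
    length adj                                       ∎
    where open ≤-Reasoning hiding (start)

  -- The constant is 250 = 2 (12 + 10 + 10 + 93): 12 per array position, 10 per chosen vertex, 10
  -- per arc and 93 per unit of `fan`, each total being at most 2 m δ̄. The 4-cycles need only 70 +
  -- 22.
  sum-budget : 4 + 12 * length adj + sum (map budget chosen) ≤ 250 * (1 + (minDegreeSum G + #C4 G))
  sum-budget = begin
    4 + 12 * length adj + sum (map budget chosen)
      ≡⟨ cong (4 + 12 * length adj +_) split ⟩
    4 + 12 * length adj + (10 * length chosen + 10 * sum (map deg chosen) + 93 * sum (map fan chosen)
       + 70 * sum (map low chosen) + 22 * sum (map high chosen))
      ≤⟨ +-mono-≤ (+-monoʳ-≤ 4 (*-monoʳ-≤ 12 length-adj≤minDegreeSum))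
           (+-mono-≤ (+-mono-≤ (+-mono-≤ (+-mono-≤
             (*-monoʳ-≤ 10 (≤-trans length-chosen length-adj≤minDegreeSum))
             (*-monoʳ-≤ 10 (≤-trans (sum-chosen-≤ deg) (≤-trans (≤-reflexive (sym length-adj)) length-adj≤minDegreeSum))))
             (*-monoʳ-≤ 93 (≤-trans (sum-chosen-≤ fan) sum-fan)))
             (*-monoʳ-≤ 70 (≤-trans (≤-reflexive (sym (length-concatMap cycles chosen))) (Low.length-found L chosen-Unique))))
             (*-monoʳ-≤ 22 (≤-trans (≤-reflexive (sym (length-concatMap (λ v → pairs v (highPaths v)) chosen)))
               (High.length-found L chosen-Unique)))) ⟩
    4 + 12 * (2 * S) + (10 * (2 * S) + 10 * (2 * S) + 93 * (2 * S) + 70 * C + 22 * C)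
      ≤⟨ m≤m+n _ (246 + 158 * C) ⟩
    4 + 12 * (2 * S) + (10 * (2 * S) + 10 * (2 * S) + 93 * (2 * S) + 70 * C + 22 * C) + (246 + 158 * C)
      ≡⟨ collect S C ⟩
    250 * (1 + (S + C)) ∎
    where
    open ≤-Reasoning hiding (start)
    S C : ℕ
    S = minDegreeSum G
    C = #C4 G
    low high : Fin n → ℕ
    low v  = length (cycles v)
    high v = length (pairs v (highPaths v))
    collect : ∀ S C → 4 + 12 * (2 * S) + (10 * (2 * S) + 10 * (2 * S) + 93 * (2 * S) + 70 * C + 22 * C) + (246 + 158 * C) ≡ 250 * (1 + (S + C))
    collect = solve-∀
    const-sum : ∀ (vs : List (Fin n)) → sum (map (λ _ → 10) vs) ≡ 10 * length vs
    const-sum vs = trans (sum-map-* 10 (λ _ → 1) vs) (cong (10 *_) (sym (length-sum vs)))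
    split : sum (map budget chosen) ≡ 10 * length chosen + 10 * sum (map deg chosen) + 93 * sum (map fan chosen)
       + 70 * sum (map low chosen) + 22 * sum (map high chosen)
    split = trans (sum-map-+ (λ v → 10 + 10 * deg v + 93 * fan v + 70 * low v) (λ v → 22 * high v) chosen) (cong₂ _+_
      (trans (sum-map-+ (λ v → 10 + 10 * deg v + 93 * fan v) (λ v → 70 * low v) chosen) (cong₂ _+_
        (trans (sum-map-+ (λ v → 10 + 10 * deg v) (λ v → 93 * fan v) chosen) (cong₂ _+_
          (trans (sum-map-+ (λ _ → 10) (λ v → 10 * deg v) chosen) (cong₂ _+_ (const-sum chosen) (sum-map-* 10 deg chosen)))
          (sum-map-* 93 fan chosen)))
        (sum-map-* 70 low chosen)))
      (sum-map-* 22 high chosen))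

  -- Since `length adj ≤ n * n`, the left side is bounded by a cubic polynomial in `n`, which the
  -- expanded fourth power of `2 + n` exceeds coefficient by coefficient.
  words : n * length adj + length adj + n + 1 < wordBound 4 n
  words = begin-strict
    n * length adj + length adj + n + 1   ≤⟨ +-monoˡ-≤ 1 (+-monoˡ-≤ n (+-mono-≤ (*-monoʳ-≤ n length-adj≤) length-adj≤)) ⟩
    n * (n * n) + n * n + n + 1           <⟨ n<1+n _ ⟩
    suc (n * (n * n) + n * n + n + 1)     ≤⟨ m≤m+n _ (n * (n * (n * n)) + 7 * (n * (n * n)) + 23 * (n * n) + 31 * n + 14) ⟩
    suc (n * (n * n) + n * n + n + 1) + (n * (n * (n * n)) + 7 * (n * (n * n)) + 23 * (n * n) + 31 * n + 14)
                                          ≡⟨ expand n ⟩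
    wordBound 4 n                         ∎
    where
    open ≤-Reasoning hiding (start)
    expand : ∀ n → suc (n * (n * n) + n * n + n + 1) + (n * (n * (n * n)) + 7 * (n * (n * n)) + 23 * (n * n) + 31 * n + 14)
      ≡ (2 + n) * ((2 + n) * ((2 + n) * ((2 + n) * 1)))
    expand = solve-∀

-- From the ordered specification to the actual output

Enumerates-resp-↭ : ∀ {n} {G : Graph n} {os os′} → os ↭ os′ → Enumerates G os → Enumerates G os′
Enumerates-resp-↭ {n} perm e = record
  { sound    = All-resp-↭ perm (Enumerates.sound e)
  ; complete = λ q c → Any-resp-↭ perm (Enumerates.complete e q c)
  ; distinct = Permutation.AllPairs-resp-↭ (setoid (Quad (Fin n)))
      (λ {p} {q} p≉q q≈p → p≉q (≈-sym {p = q} {p} q≈p)) ((λ { refl h → h }) , λ { refl h → h })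
      (↭⇒↭ₛ perm) (Enumerates.distinct e) }

theorem4 : Σ[ k ∈ ℕ ] Σ[ a ∈ ℕ ] Σ[ p ∈ Program k a ] Σ[ e ∈ ℕ ] Σ[ c ∈ ℕ ]
    EnumeratesC4Within p e c
-- All four arrays have length `n`: heads are indexed by vertices; keys, items and links by the
-- slots of the buffer. The 250 of the time bound is ample for 24 + 4 n words.
theorem4 = 24 , 4 , main , 4 , 250 , λ n → n , space n , λ G L σ₀ →
  let open Budget L
      open Adjacency L
      open AdjacencyLists L
      open Semantics L {24} {4} n (wordBound 4 n)
      n≤words = ≤-trans (m≤n+m n (n * length adj + length adj)) (m≤m+n _ 1)
      adj≤words = ≤-trans (m≤n+m (length adj) (n * length adj)) (≤-trans (m≤m+n _ n) (m≤m+n _ 1))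
      S′ , exec = Correctness.main-exec L (wordBound 4 n) words budget budget-enough (abstraction σ₀)
      t , out , σ′ , ran , t≤ , perm , _ = simulate (≤-<-trans n≤words words) (≤-<-trans adj≤words words) segment≤ (abstraction-≋ σ₀) exec
  in t , out , σ′ , ran ,
     Enumerates-resp-↭ (↭-sym perm) (enumerates L chosen-Unique ∈-chosen) ,
     ≤-timeBound G 250 (≤-trans t≤ sum-budget)
  where
  space : ∀ n → 24 + 4 * n ≤ spaceBound 250 n
  space n = ≤-trans (m≤m+n _ (226 + 246 * n)) (≤-reflexive (expand n))
    where
    expand : ∀ n → 24 + 4 * n + (226 + 246 * n) ≡ 250 * (1 + n)
    expand = solve-∀
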